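{- Let $h(n,k)$ denote the number of nonisomorphic $k$-element graded posets $P$ of rank $n$ with $\hat0$ and $\hat1$ for which the flag $h$-vector $\beta_P$ is multiplicity-free. Let $$U(x,y)=\sum_{n\ge1}\sum_{k\ge2}h(n,k)x^ny^k.$$ Then $$U(x,y)=\frac{xy^2(1-xy^2)(1-3xy^2)}{1-xy-5xy^2+4x^2y^3+5x^2y^4-3x^3y^5}.$$
   Context: For a finite graded poset $P$ of rank $n$ with $\hat0,\hat1$ and rank function $\rho$, the flag $f$-vector is $\alpha_P(S)=$ number of chains $C$ of $P$ with $\{\rho(t):t\in C\}=S$, for $S\subseteq[n-1]$, and the flag $h$-vector is $\beta_P(S)=\sum_{T\subseteq S}(-1)^{\#(S-T)}\alpha_P(T)$. $\beta_P$ is multiplicity-free if $\beta_P(S)\in\{0,1,-1\}$ for all $S\subseteq[n-1]$. -}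

module Defs where

open import Data.Bool using (Bool; true; false; _∧_; _∨_; not; if_then_else_; T)
open import Data.Nat as ℕ using (ℕ; zero; suc; _≤ᵇ_; _≡ᵇ_; _∸_)
open import Data.Integer as ℤ using (ℤ; +_; -_)
open import Data.Fin using (Fin; toℕ; _≟_)
open import Data.Vec using (Vec; []; _∷_; lookup)
open import Data.List using (List; []; _∷_; map; _++_; allFin; length; filterᵇ; foldr)
open import Data.Bool.ListAction using (and; or)
open import Data.Product using (Σ; _×_; _,_)
open import Data.Sum using (_⊎_)
open import Data.Fin.Permutation using (Permutation′; _⟨$⟩ʳ_)
open import Relation.Nullary.Decidable using (⌊_⌋)
open import Relation.Binary.PropositionalEquality using (_≡_)

allᶠ : {k : ℕ} → (Fin k → Bool) → Bool
allᶠ {k} p = and (map p (allFin k))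

anyᶠ : {k : ℕ} → (Fin k → Bool) → Bool
anyᶠ {k} p = or (map p (allFin k))

allSubsets : (m : ℕ) → List (Vec Bool m)
allSubsets zero = [] ∷ []
allSubsets (suc m) = map (true ∷_) (allSubsets m) ++ map (false ∷_) (allSubsets m)

_⇒ᵇ_ : Bool → Bool → Bool
a ⇒ᵇ b = not a ∨ b

record FinPoset (k : ℕ) : Set where
  field
    _≼_      : Fin k → Fin k → Bool
    reflexive : ∀ x → T (x ≼ x)
    antisym   : ∀ x y → T (x ≼ y) → T (y ≼ x) → x ≡ y
    transitive : ∀ x y z → T (x ≼ y) → T (y ≼ z) → T (x ≼ z)

  _≺_ : Fin k → Fin k → Bool
  x ≺ y = (x ≼ y) ∧ not ⌊ x ≟ y ⌋

  _⋖_ : Fin k → Fin k → Bool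
  x ⋖ y = (x ≺ y) ∧ not (anyᶠ (λ z → (x ≺ z) ∧ (z ≺ y)))

record GradedPoset (n k : ℕ) : Set where
  field
    poset : FinPoset k
  open FinPoset poset public
  field
    bot top      : Fin k
    bot-least    : ∀ x → T (bot ≼ x)
    top-greatest : ∀ x → T (x ≼ top)
    ρ            : Fin k → ℕ
    ρ-bot        : ρ bot ≡ 0
    ρ-top        : ρ top ≡ n
    ρ-cover      : ∀ x y → T (x ⋖ y) → ρ y ≡ suc (ρ x)

-- Flag f- and h-vectors.  A subset S ⊆ [n-1] is a vector S : Vec Bool (n ∸ 1),
-- where index i : Fin (n ∸ 1) stands for the rank toℕ i + 1.

RankSet : ℕ → Set
RankSet n = Vec Bool (n ∸ 1)

module _ {n k : ℕ} (P : GradedPoset n k) where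
  open GradedPoset P

  isChainᵇ : Vec Bool k → Bool
  isChainᵇ C = allᶠ (λ x → allᶠ (λ y →
    (lookup C x ∧ lookup C y) ⇒ᵇ ((x ≼ y) ∨ (y ≼ x))))

  rankSetIsᵇ : RankSet n → Vec Bool k → Bool
  rankSetIsᵇ S C =
    allᶠ (λ x → lookup C x ⇒ᵇ anyᶠ (λ i → lookup S i ∧ (ρ x ≡ᵇ suc (toℕ i))))
    ∧ allᶠ (λ i → lookup S i ⇒ᵇ anyᶠ (λ x → lookup C x ∧ (ρ x ≡ᵇ suc (toℕ i))))

  α : RankSet n → ℕ
  α S = length (filterᵇ (λ C → isChainᵇ C ∧ rankSetIsᵇ S C) (allSubsets k))

  sizeDiff : RankSet n → RankSet n → ℕ
  sizeDiff S U = length (filterᵇ (λ i → lookup S i ∧ not (lookup U i)) (allFin (n ∸ 1)))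

  sign : ℕ → ℤ
  sign zero = + 1
  sign (suc m) = - sign m

  subsetᵇ : RankSet n → RankSet n → Bool
  subsetᵇ U S = allᶠ (λ i → lookup U i ⇒ᵇ lookup S i)

  β : RankSet n → ℤ
  β S = foldr (λ U acc → sign (sizeDiff S U) ℤ.* + α U ℤ.+ acc) (+ 0)
              (filterᵇ (λ U → subsetᵇ U S) (allSubsets (n ∸ 1)))

  MultiplicityFree : Set
  MultiplicityFree = ∀ (S : RankSet n) → (β S ≡ + 0) ⊎ ((β S ≡ + 1) ⊎ (β S ≡ - + 1))

-- poset isomorphism (the rank function is determined by the order)
Isomorphic : {n k : ℕ} → GradedPoset n k → GradedPoset n k → Set
Isomorphic {n} {k} P Q = Σ (Permutation′ k) λ π →
  ∀ x y → GradedPoset._≼_ P x y ≡ GradedPoset._≼_ Q (π ⟨$⟩ʳ x) (π ⟨$⟩ʳ y)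

IsoClassCount : ℕ → ℕ → ℕ → Set
IsoClassCount n k m =
  Σ (Fin m → GradedPoset n k) λ reps →
    (∀ i → MultiplicityFree (reps i))
    × (∀ i j → Isomorphic (reps i) (reps j) → i ≡ j)
    × (∀ (P : GradedPoset n k) → MultiplicityFree P → Σ (Fin m) λ i → Isomorphic P (reps i))

-- Formal power series in x, y with integer coefficients: coefficient of x^n y^k.

Series : Set
Series = ℕ → ℕ → ℤ

sumUpTo : ℕ → (ℕ → ℤ) → ℤ
sumUpTo zero f = f 0
sumUpTo (suc m) f = sumUpTo m f ℤ.+ f (suc m)

_⋆_ : Series → Series → Series
(f ⋆ g) n k = sumUpTo n (λ i → sumUpTo k (λ j → f i j ℤ.* g (n ∸ i) (k ∸ j)))

poly : List (ℕ × ℕ × ℤ) → Series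
poly [] n k = + 0
poly ((a , b , c) ∷ ts) n k =
  (if (a ≡ᵇ n) ∧ (b ≡ᵇ k) then c else + 0) ℤ.+ poly ts n k

denom : Series
denom = poly ((0 , 0 , + 1) ∷ (1 , 1 , - + 1) ∷ (1 , 2 , - + 5)
            ∷ (2 , 3 , + 4) ∷ (2 , 4 , + 5) ∷ (3 , 5 , - + 3) ∷ [])

-- numerator xy²(1 - xy²)(1 - 3xy²) = xy² - 4x²y⁴ + 3x³y⁶
numer : Series
numer = poly ((1 , 2 , + 1) ∷ (2 , 4 , - + 4) ∷ (3 , 6 , + 3) ∷ [])

U : (ℕ → ℕ → ℕ) → Series
U h n k = if (1 ≤ᵇ n) ∧ (2 ≤ᵇ k) then + h n k else + 0

{-# OPTIONS --safe #-}

-- β({i}) = α({i}) − 1 forces every rank of a multiplicity-free poset to have at most two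
-- elements; conversely this suffices.  Such a poset is read off level by level: a rank is
-- a single point or a pair, and two consecutive pairs are joined by K₂₂ (full), by 2K₂ (par)
-- or by a path (zig).  A path distinguishes the two elements of both its ranks, and par
-- transports the distinction, so up to isomorphism one has to remember whether the current
-- rank is a point, a pair with interchangeable elements, or an oriented pair.  Isomorphism
-- classes are thus the walks of a three-state automaton, and the denominator of U is the
-- characteristic polynomial of its transfer matrix.
--
-- For the converse, let B_V(S) be the alternating sum of the numbers of chains above a
-- nonempty set V of elements of the current rank.  The four numbers B_a, B_b, B_ab and
-- B_a + B_b − B_ab of a pair {a, b} stay in {0, 1, −1} when a rank is added below.
module Submission where

open import Defs
open import Data.Bool using (Bool; true; false; _∧_; _∨_; not; _xor_; T; if_then_else_)
open import Data.Bool.Properties using (T?; T-∧; T-∨)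
open import Data.Empty using (⊥; ⊥-elim)
open import Data.Fin using (Fin; zero; suc; toℕ; fromℕ<; _≟_)
open import Data.Fin.Induction using (spo-wellFounded; spo-noetherian)
open import Data.Fin.Permutation as Perm using (Permutation; permutation; ↔⇒≡; _⟨$⟩ʳ_; _⟨$⟩ˡ_; inverseˡ; inverseʳ)
open import Data.Fin.Properties using (any?; toℕ<n; toℕ-fromℕ<; ¬Fin0; +↔⊎)
open import Data.Integer as ℤ using (ℤ; +_; -_; _-_)
import Data.Integer.Properties as ℤ
open import Data.Integer.Solver using (module +-*-Solver)
open import Data.List using (List; []; _∷_; map; _++_; foldr; filterᵇ; length; allFin; tabulate)
import Data.List.Membership.Propositional as List
open import Data.List.Membership.Propositional.Properties using (∈-allFin; ∈-map⁺; ∈-++⁺ˡ; ∈-++⁺ʳ; ∈-filter⁺)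
open import Data.List.Properties using (foldr-++; foldr-map; foldr-cong; filter-++; length-++)
open import Data.List.Relation.Unary.All as All using ()
import Data.List.Relation.Unary.All.Properties as All
open import Data.List.Relation.Unary.Any as Any using (here; there)
import Data.List.Relation.Unary.Any.Properties as Any
open import Data.Nat as ℕ using (ℕ; zero; suc; _≡ᵇ_; _∸_; _<_; _≤_; s≤s; z≤n)
import Data.Nat.Properties as ℕ
open import Data.Product using (Σ; _×_; _,_; proj₁; proj₂)
open import Data.Sum using (_⊎_; inj₁; inj₂)
open import Data.Sum.Function.Propositional using (_⊎-↔_)
open import Data.Unit using (⊤; tt)
open import Data.Vec using (Vec; []; _∷_; lookup)
open import Function using (_∘_; flip)
open import Function.Bundles using (Equivalence; Inverse; _↔_; mk↔ₛ′)
open import Function.Construct.Composition using (_↔-∘_)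
open import Function.Construct.Symmetry using (↔-sym)
open import Induction.WellFounded using (Acc; acc)
open import Relation.Binary.PropositionalEquality using (_≡_; _≢_; refl; sym; trans; cong; cong₂; subst; subst₂; isEquivalence; module ≡-Reasoning)
open import Relation.Binary.Structures using (IsStrictPartialOrder)
open import Relation.Nullary using (¬_; yes; no)
open import Relation.Nullary.Decidable using (_×-dec_; ¬?)

-- The four numbers of a pair are closed under adding a rank because selecting a rank compares the
-- chains through it with those skipping it. If only one of its elements lies above `V`, the two
-- counts agree and give 0; if both do, they give B_a + B_b - B_ab. The delicate point of the
-- classification is the labels. Whether the elements of a pair are interchangeable is decided by
-- the ranks below, but their order may be prescribed by a path further up. Labels are therefore
-- handled only up to the swaps that the state permits, both for existence and for uniqueness of the
-- walk. With a = xy and b = xy² the transfer matrix has the rows (a, b, 0), (a, 2b, b), (a, b, 3b),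
-- and its characteristic polynomial is D = 1 - a - 5b + 4ab + 5b² - 3ab². Walks from a point have
-- the series (1 - 5b + 5b²)/D. Removing the empty walk leaves a(1 - b)(1 - 3b)/D, and the bottom
-- element supplies the last factor y of the numerator.

-- Boolean reflection and the strict order

∧-intro : ∀ {a b} → T a → T b → T (a ∧ b)
∧-intro p q = Equivalence.from T-∧ (p , q)

∧-elim : ∀ {a b} → T (a ∧ b) → T a × T b
∧-elim = Equivalence.to T-∧

∨-elim : ∀ {a b} → T (a ∨ b) → T a ⊎ T b
∨-elim = Equivalence.to T-∨

not-intro : ∀ {a} → ¬ T a → T (not a)
not-intro {false} _ = tt
not-intro {true}  f = f tt

not-elim : ∀ {a} → T (not a) → ¬ T a
not-elim {false} _ ()

T-ext : ∀ {a b} → (T a → T b) → (T b → T a) → a ≡ b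
T-ext {false} {false} f g = refl
T-ext {false} {true}  f g = ⊥-elim (g tt)
T-ext {true}  {false} f g = ⊥-elim (f tt)
T-ext {true}  {true}  f g = refl

⇒-intro : ∀ {a b} → (T a → T b) → T (a ⇒ᵇ b)
⇒-intro {false} f = tt
⇒-intro {true}  f = f tt

⇒-elim : ∀ {a b} → T (a ⇒ᵇ b) → T a → T b
⇒-elim {true} p _ = p

allᶠ-intro : ∀ {k} {p : Fin k → Bool} → (∀ x → T (p x)) → T (allᶠ p)
allᶠ-intro {p = p} f = All.all⁻ p {xs = allFin _} (All.tabulate (λ {x} _ → f x))

allᶠ-elim : ∀ {k} {p : Fin k → Bool} → T (allᶠ p) → ∀ x → T (p x)
allᶠ-elim {p = p} t x = All.lookup (All.all⁺ p (allFin _) t) (∈-allFin x)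

anyᶠ-intro : ∀ {k} (p : Fin k → Bool) x → T (p x) → T (anyᶠ p)
anyᶠ-intro p x t = Any.any⁺ p (List.lose (∈-allFin x) t)

anyᶠ-elim : ∀ {k} (p : Fin k → Bool) → T (anyᶠ p) → Σ (Fin k) (T ∘ p)
anyᶠ-elim p t = Any.satisfied (Any.any⁻ p (allFin _) t)

module Strict {k} (P : FinPoset k) where
  open FinPoset P

  ≺-intro : ∀ {x y} → T (x ≼ y) → x ≢ y → T (x ≺ y)
  ≺-intro {x} {y} l d with x ≟ y
  ... | yes p = ⊥-elim (d p)
  ... | no  _ = ∧-intro {x ≼ y} l tt

  ≺-elim : ∀ {x y} → T (x ≺ y) → T (x ≼ y) × x ≢ y
  ≺-elim {x} {y} t with x ≟ y
  ... | yes p = ⊥-elim (proj₂ (∧-elim {x ≼ y} t))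
  ... | no  d = proj₁ (∧-elim {x ≼ y} t) , d

  ⋖-intro : ∀ {x y} → T (x ≺ y) → (∀ z → T (x ≺ z) → ¬ T (z ≺ y)) → T (x ⋖ y)
  ⋖-intro {x} {y} l f = ∧-intro l (not-intro λ t →
    let z , s = anyᶠ-elim (λ z → (x ≺ z) ∧ (z ≺ y)) t
        a , b = ∧-elim s
    in f z a b)

  ⋖-elim : ∀ {x y} → T (x ⋖ y) → T (x ≺ y) × (∀ z → T (x ≺ z) → ¬ T (z ≺ y))
  ⋖-elim {x} {y} t =
    let a , b = ∧-elim {x ≺ y} t
    in a , λ z p q → not-elim b (anyᶠ-intro (λ z → (x ≺ z) ∧ (z ≺ y)) z (∧-intro p q))

-- Codes and the posets they describe

data State : Set where
  point pair oriented : State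

data Edge : State → State → Set where
  full : ∀ {q} → Edge q pair
  par  : Edge pair pair
  zig  : Edge pair oriented
  parᵒ zigˡ zigʳ : Edge oriented oriented

-- zig, zigˡ and zigʳ always label the upper element that covers both lower ones by true.
graph : ∀ {q q′} → Edge q q′ → Bool → Bool → Bool
graph full s t = true
graph par  s t = not (s xor t)
graph zig  s t = not s ∨ t
graph parᵒ s t = not (s xor t)
graph zigˡ s t = not s ∨ t
graph zigʳ s t = s ∨ t

-- Code q n k describes n ranks with k elements in total, lying above a rank in state q;
-- the elements of a rank come first in Fin k.  The two labels of a point name the same element.
data Code : State → ℕ → ℕ → Set where
  nil : Code point 0 0
  one : ∀ {q n k} → Code point n k → Code q (suc n) (suc k)
  two : ∀ {q q′ n k} → Edge q q′ → Code q′ n k → Code q (suc n) (suc (suc k))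

anyᵇ : (Bool → Bool) → Bool
anyᵇ p = p false ∨ p true

anyᵇ-intro : ∀ p t → T (p t) → T (anyᵇ p)
anyᵇ-intro p t h with p false in eq
... | true  = tt
anyᵇ-intro p false h | false = ⊥-elim (subst T eq h)
anyᵇ-intro p true  h | false = h

anyᵇ-elim : ∀ p → T (anyᵇ p) → Σ Bool (T ∘ p)
anyᵇ-elim p h with ∨-elim {p false} h
... | inj₁ a = false , a
... | inj₂ b = true , b

rel : ∀ {q n k} → Code q n k → Bool → Fin k → Bool
rel (one c)   s zero          = true
rel (one c)   s (suc y)       = rel c false y
rel (two e c) s zero          = graph e s false
rel (two e c) s (suc zero)    = graph e s true
rel (two e c) s (suc (suc y)) = anyᵇ λ t → graph e s t ∧ rel c t y

le : ∀ {q n k} → Code q n k → Fin k → Fin k → Bool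
le (one c)   zero          zero          = true
le (one c)   zero          (suc y)       = rel c false y
le (one c)   (suc x)       zero          = false
le (one c)   (suc x)       (suc y)       = le c x y
le (two e c) zero          zero          = true
le (two e c) zero          (suc zero)    = false
le (two e c) zero          (suc (suc y)) = rel c false y
le (two e c) (suc zero)    zero          = false
le (two e c) (suc zero)    (suc zero)    = true
le (two e c) (suc zero)    (suc (suc y)) = rel c true y
le (two e c) (suc (suc x)) zero          = false
le (two e c) (suc (suc x)) (suc zero)    = false
le (two e c) (suc (suc x)) (suc (suc y)) = le c x y

rk : ∀ {q n k} → Code q n k → Fin k → ℕ
rk (one c)   zero          = 0
rk (one c)   (suc x)       = suc (rk c x)
rk (two e c) zero          = 0
rk (two e c) (suc zero)    = 0
rk (two e c) (suc (suc x)) = suc (rk c x)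

side : ∀ {k} → Bool → Fin (suc (suc k))
side false = zero
side true  = suc zero

rel-side : ∀ {q q′ n k} (e : Edge q q′) (c : Code q′ n k) s t → rel (two e c) s (side t) ≡ graph e s t
rel-side e c s false = refl
rel-side e c s true  = refl

le-side : ∀ {q q′ n k} (e : Edge q q′) (c : Code q′ n k) t y → le (two e c) (side t) (suc (suc y)) ≡ rel c t y
le-side e c false y = refl
le-side e c true  y = refl

-- Only `full` leaves `point` among the edges, and its graph ignores the labels. Hence label `false`
-- can stand for a point everywhere, as it does in `rel` and `le`.
rel-point : ∀ {n k} (c : Code point n k) s y → rel c s y ≡ rel c false y
rel-point (one c)      s zero          = refl
rel-point (one c)      s (suc y)       = refl
rel-point (two full c) s zero          = refl
rel-point (two full c) s (suc zero)    = refl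
rel-point (two full c) s (suc (suc y)) = refl

rel-two : ∀ {q q′ n k} (e : Edge q q′) (c : Code q′ n k) s y →
          T (rel (two e c) s (suc (suc y))) → Σ Bool λ t → T (graph e s t) × T (rel c t y)
rel-two e c s y h =
  let t , a = anyᵇ-elim (λ t → graph e s t ∧ rel c t y) h in t , ∧-elim {graph e s t} a

two-rel : ∀ {q q′ n k} (e : Edge q q′) (c : Code q′ n k) s t y →
          T (graph e s t) → T (rel c t y) → T (rel (two e c) s (suc (suc y)))
two-rel e c s t y a b = anyᵇ-intro (λ t → graph e s t ∧ rel c t y) t (∧-intro a b)

graph-total : ∀ {q q′} (e : Edge q q′) s → Σ Bool λ t → T (graph e s t)
graph-total full s     = true , tt
graph-total par  false = false , tt
graph-total par  true  = true , tt
graph-total zig  false = true , tt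
graph-total zig  true  = true , tt
graph-total parᵒ false = false , tt
graph-total parᵒ true  = true , tt
graph-total zigˡ false = true , tt
graph-total zigˡ true  = true , tt
graph-total zigʳ false = true , tt
graph-total zigʳ true  = true , tt

graph-onto : ∀ {q q′} (e : Edge q q′) t → Σ Bool λ s → T (graph e s t)
graph-onto full t     = true , tt
graph-onto par  false = false , tt
graph-onto par  true  = true , tt
graph-onto zig  t     = false , tt
graph-onto parᵒ false = false , tt
graph-onto parᵒ true  = true , tt
graph-onto zigˡ t     = false , tt
graph-onto zigʳ t     = true , tt

rel-onto : ∀ {q n k} (c : Code q n k) y → Σ Bool λ s → T (rel c s y)
rel-onto (one c)   zero          = false , tt
rel-onto (one c)   (suc y)       = false , subst T (rel-point c _ y) (proj₂ (rel-onto c y))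
rel-onto (two e c) zero          = graph-onto e false
rel-onto (two e c) (suc zero)    = graph-onto e true
rel-onto (two e c) (suc (suc y)) =
  let t , b = rel-onto c y
      s , a = graph-onto e t
  in s , two-rel e c s t y a b

le-refl : ∀ {q n k} (c : Code q n k) x → T (le c x x)
le-refl (one c)   zero          = tt
le-refl (one c)   (suc x)       = le-refl c x
le-refl (two e c) zero          = tt
le-refl (two e c) (suc zero)    = tt
le-refl (two e c) (suc (suc x)) = le-refl c x

le-antisym : ∀ {q n k} (c : Code q n k) x y → T (le c x y) → T (le c y x) → x ≡ y
le-antisym (one c)   zero          zero          p r = refl
le-antisym (one c)   (suc x)       (suc y)       p r = cong suc (le-antisym c x y p r)
le-antisym (two e c) zero          zero          p r = refl
le-antisym (two e c) zero          (suc zero)    () r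
le-antisym (two e c) zero          (suc (suc y)) p ()
le-antisym (two e c) (suc zero)    zero          () r
le-antisym (two e c) (suc zero)    (suc zero)    p r = refl
le-antisym (two e c) (suc (suc x)) zero          () r
le-antisym (two e c) (suc (suc x)) (suc zero)    () r
le-antisym (two e c) (suc (suc x)) (suc (suc y)) p r = cong (λ i → suc (suc i)) (le-antisym c x y p r)

-- Transitivity with the least of the three elements replaced by a label of the rank just below the
-- code; `le-trans` falls back on it when its first element lies in the first rank.
rel-le : ∀ {q n k} (c : Code q n k) s x y → T (rel c s x) → T (le c x y) → T (rel c s y)
rel-le (one c)   s zero          zero          p r = tt
rel-le (one c)   s zero          (suc y)       p r = r
rel-le (one c)   s (suc x)       (suc y)       p r = rel-le c false x y p r
rel-le (two e c) s zero          zero          p r = p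
rel-le (two e c) s zero          (suc (suc y)) p r = two-rel e c s false y p r
rel-le (two e c) s (suc zero)    (suc zero)    p r = p
rel-le (two e c) s (suc zero)    (suc (suc y)) p r = two-rel e c s true y p r
rel-le (two e c) s (suc (suc x)) (suc (suc y)) p r =
  let t , a , b = rel-two e c s x p in two-rel e c s t y a (rel-le c t x y b r)

le-trans : ∀ {q n k} (c : Code q n k) x y z → T (le c x y) → T (le c y z) → T (le c x z)
le-trans (one c)   zero          zero          z             p r = r
le-trans (one c)   zero          (suc y)       (suc z)       p r = rel-le c false y z p r
le-trans (one c)   (suc x)       (suc y)       (suc z)       p r = le-trans c x y z p r
le-trans (two e c) zero          zero          z             p r = r
le-trans (two e c) zero          (suc (suc y)) (suc (suc z)) p r = rel-le c false y z p r
le-trans (two e c) (suc zero)    (suc zero)    z             p r = r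
le-trans (two e c) (suc zero)    (suc (suc y)) (suc (suc z)) p r = rel-le c true y z p r
le-trans (two e c) (suc (suc x)) (suc (suc y)) (suc (suc z)) p r = le-trans c x y z p r

codePoset : ∀ {q n k} → Code q n k → FinPoset k
codePoset c = record
  { _≼_ = le c ; reflexive = le-refl c ; antisym = le-antisym c ; transitive = le-trans c }

rel-step : ∀ {q n k} (c : Code q n k) s y → T (rel c s y) →
           Σ (Fin k) λ z → rk c z ≡ 0 × T (rel c s z) × T (le c z y)
rel-step (one c)   s zero          p = zero , refl , tt , tt
rel-step (one c)   s (suc y)       p = zero , refl , tt , p
rel-step (two e c) s zero          p = zero , refl , p , tt
rel-step (two e c) s (suc zero)    p = suc zero , refl , p , tt
rel-step (two e c) s (suc (suc y)) p with rel-two e c s y p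
... | false , a , b = zero , refl , a , b
... | true  , a , b = suc zero , refl , a , b

-- `rel` ascends one rank at a time, so a strict inequality factors through the next rank. For a
-- cover the intermediate element must be the upper one, which is how `rk-cover` follows.
le-step : ∀ {q n k} (c : Code q n k) x y → T (le c x y) → x ≢ y →
          Σ (Fin k) λ z → rk c z ≡ suc (rk c x) × T (le c x z) × T (le c z y)
le-step (one c)   zero          zero          p d = ⊥-elim (d refl)
le-step (one c)   zero          (suc y)       p d =
  let z , a , b , r = rel-step c false y p in suc z , cong suc a , b , r
le-step (one c)   (suc x)       (suc y)       p d =
  let z , a , b , r = le-step c x y p (d ∘ cong suc) in suc z , cong suc a , b , r
le-step (two e c) zero          zero          p d = ⊥-elim (d refl)
le-step (two e c) zero          (suc (suc y)) p d =
  let z , a , b , r = rel-step c false y p in suc (suc z) , cong suc a , b , r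
le-step (two e c) (suc zero)    (suc zero)    p d = ⊥-elim (d refl)
le-step (two e c) (suc zero)    (suc (suc y)) p d =
  let z , a , b , r = rel-step c true y p in suc (suc z) , cong suc a , b , r
le-step (two e c) (suc (suc x)) (suc (suc y)) p d =
  let z , a , b , r = le-step c x y p (d ∘ cong (λ i → suc (suc i))) in suc (suc z) , cong suc a , b , r

rk-cover : ∀ {q n k} (c : Code q n k) x y → T (FinPoset._⋖_ (codePoset c) x y) → rk c y ≡ suc (rk c x)
rk-cover c x y h with Strict.⋖-elim (codePoset c) h
... | x≺y , gap with Strict.≺-elim (codePoset c) {x} x≺y
... | x≼y , x≢y with le-step c x y x≼y x≢y
... | z , rz , x≼z , z≼y with z ≟ y
... | yes refl = rz
... | no  z≢y  = ⊥-elim (gap z (≺-intro x≼z x≢z) (≺-intro z≼y z≢y))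
  where
  open Strict (codePoset c)
  x≢z : x ≢ z
  x≢z refl = ℕ.1+n≢n (sym rz)

-- `nil` lives at `point` and no edge ends there, so the last rank is always a single element.
maxElem : ∀ {q n k} → Code q (suc n) k → Fin k
maxElem (one nil)            = zero
maxElem (one c@(one _))      = suc (maxElem c)
maxElem (one c@(two _ _))    = suc (maxElem c)
maxElem (two e c@(one _))    = suc (suc (maxElem c))
maxElem (two e c@(two _ _))  = suc (suc (maxElem c))

rel-max : ∀ {q n k} (c : Code q (suc n) k) s → T (rel c s (maxElem c))
rel-max (one nil)           s = tt
rel-max (one c@(one _))     s = rel-max c false
rel-max (one c@(two _ _))   s = rel-max c false
rel-max (two e c@(one _))   s = let t , a = graph-total e s in two-rel e c s t (maxElem c) a (rel-max c t)
rel-max (two e c@(two _ _)) s = let t , a = graph-total e s in two-rel e c s t (maxElem c) a (rel-max c t)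

le-max : ∀ {q n k} (c : Code q (suc n) k) x → T (le c x (maxElem c))
le-max (one nil)           zero          = tt
le-max (one c@(one _))     zero          = rel-max c false
le-max (one c@(one _))     (suc x)       = le-max c x
le-max (one c@(two _ _))   zero          = rel-max c false
le-max (one c@(two _ _))   (suc x)       = le-max c x
le-max (two e c@(one _))   zero          = rel-max c false
le-max (two e c@(one _))   (suc zero)    = rel-max c true
le-max (two e c@(one _))   (suc (suc x)) = le-max c x
le-max (two e c@(two _ _)) zero          = rel-max c false
le-max (two e c@(two _ _)) (suc zero)    = rel-max c true
le-max (two e c@(two _ _)) (suc (suc x)) = le-max c x

rk-max : ∀ {q n k} (c : Code q (suc n) k) → rk c (maxElem c) ≡ n
rk-max (one nil)           = refl
rk-max (one c@(one _))     = cong suc (rk-max c)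
rk-max (one c@(two _ _))   = cong suc (rk-max c)
rk-max (two e c@(one _))   = cong suc (rk-max c)
rk-max (two e c@(two _ _)) = cong suc (rk-max c)

codeGraded : ∀ {n k} → Code point n k → GradedPoset n (suc k)
codeGraded c = record
  { poset        = codePoset d
  ; bot          = zero
  ; top          = maxElem d
  ; bot-least    = λ { zero → tt ; (suc y) → subst T (rel-point c _ y) (proj₂ (rel-onto c y)) }
  ; top-greatest = le-max d
  ; ρ            = rk d
  ; ρ-bot        = refl
  ; ρ-top        = rk-max d
  ; ρ-cover      = rk-cover d
  }
  where
  d = one {q = point} c

-- Flag vectors of codes

-- Inclusion-exclusion over the subsets of `S`, written as iterated differences so that ranks can be
-- peeled off one at a time.
alt : ∀ {m} → Vec Bool m → (Vec Bool m → ℤ) → ℤ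
alt []          F = F []
alt (true ∷ S)  F = alt S (F ∘ (true ∷_)) - alt S (F ∘ (false ∷_))
alt (false ∷ S) F = alt S (F ∘ (false ∷_))

alt-cong : ∀ {m} (S : Vec Bool m) {F G : Vec Bool m → ℤ} → (∀ U → F U ≡ G U) → alt S F ≡ alt S G
alt-cong []          h = h []
alt-cong (true ∷ S)  h = cong₂ _-_ (alt-cong S (h ∘ (true ∷_))) (alt-cong S (h ∘ (false ∷_)))
alt-cong (false ∷ S) h = alt-cong S (h ∘ (false ∷_))

alt-neg : ∀ {m} (S : Vec Bool m) F → alt S (-_ ∘ F) ≡ - alt S F
alt-neg []          F = refl
alt-neg (true ∷ S)  F = trans (cong₂ _-_ (alt-neg S _) (alt-neg S _))
  (solve 2 (λ a b → :- a :- :- b := :- (a :- b)) refl (alt S (F ∘ (true ∷_))) (alt S (F ∘ (false ∷_))))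
  where open +-*-Solver
alt-neg (false ∷ S) F = alt-neg S _

alt-+ : ∀ {m} (S : Vec Bool m) F G → alt S (λ U → F U ℤ.+ G U) ≡ alt S F ℤ.+ alt S G
alt-+ []          F G = refl
alt-+ (true ∷ S)  F G = trans (cong₂ _-_ (alt-+ S _ _) (alt-+ S _ _))
  (solve 4 (λ a b c d → (a :+ b) :- (c :+ d) := (a :- c) :+ (b :- d)) refl
    (alt S (F ∘ (true ∷_))) (alt S (G ∘ (true ∷_))) (alt S (F ∘ (false ∷_))) (alt S (G ∘ (false ∷_))))
  where open +-*-Solver
alt-+ (false ∷ S) F G = alt-+ S _ _

foldr-filter : ∀ {A B : Set} (p : A → Bool) (f : A → B → B) z xs →
               foldr f z (filterᵇ p xs) ≡ foldr (λ x r → if p x then f x r else r) z xs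
foldr-filter p f z []       = refl
foldr-filter p f z (x ∷ xs) with p x
... | true  = cong (f x) (foldr-filter p f z xs)
... | false = foldr-filter p f z xs

foldr-skip : ∀ {A B : Set} (z : B) (xs : List A) → foldr (λ _ r → r) z xs ≡ z
foldr-skip z []       = refl
foldr-skip z (x ∷ xs) = foldr-skip z xs

allᶠ-suc : ∀ {k} (p : Fin (suc k) → Bool) → allᶠ p ≡ p zero ∧ allᶠ (p ∘ suc)
allᶠ-suc {k} p = T-ext
  (λ h → ∧-intro {p zero} (allᶠ-elim {p = p} h zero) (allᶠ-intro {p = p ∘ suc} (allᶠ-elim {p = p} h ∘ suc)))
  (λ h → allᶠ-intro λ { zero → proj₁ (∧-elim {p zero} h) ; (suc x) → allᶠ-elim {p = p ∘ suc} (proj₂ (∧-elim {p zero} h)) x })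

tabulate-filter : ∀ {A : Set} {m} (p : A → Bool) (f : Fin m → A) →
                  length (filterᵇ p (tabulate f)) ≡ length (filterᵇ (p ∘ f) (allFin m))
tabulate-filter {m = zero}  p f = refl
tabulate-filter {m = suc m} p f with p (f zero)
... | true  = cong suc (trans (tabulate-filter p (f ∘ suc)) (sym (tabulate-filter (p ∘ f) suc)))
... | false = trans (tabulate-filter p (f ∘ suc)) (sym (tabulate-filter (p ∘ f) suc))

-- `allSubsets` lists the sets containing the first index before the others, so the fold splits into
-- two blocks. Generalising over the initial value lets one block start from the result of the
-- other; generalising over `F` lets the sign of a dropped index be absorbed into `F`.
β≡alt : ∀ {n k} (P : GradedPoset n k) S → β P S ≡ alt S (λ U → + α P U)
β≡alt {n} P S = trans (foldr-filter (λ U → subsetᵇ P U S) _ (+ 0) (allSubsets (n ∸ 1)))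
  (trans (go S (λ U → + α P U) (+ 0)) (ℤ.+-identityʳ _))
  where
  sub : ∀ {m} → Vec Bool m → Vec Bool m → Bool
  sub U S = allᶠ (λ i → lookup U i ⇒ᵇ lookup S i)
  diff : ∀ {m} → Vec Bool m → Vec Bool m → ℕ
  diff S U = length (filterᵇ (λ i → lookup S i ∧ not (lookup U i)) (allFin _))
  term : ∀ {m} → Vec Bool m → (Vec Bool m → ℤ) → Vec Bool m → ℤ → ℤ
  term S F U r = if sub U S then sign P (diff S U) ℤ.* F U ℤ.+ r else r

  diff-eq : ∀ {m} (S U : Vec Bool m) b → diff (b ∷ S) (b ∷ U) ≡ diff S U
  diff-eq S U false = tabulate-filter (λ i → lookup (false ∷ S) i ∧ not (lookup (false ∷ U) i)) suc
  diff-eq S U true  = tabulate-filter (λ i → lookup (true ∷ S) i ∧ not (lookup (true ∷ U) i)) suc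

  keep : ∀ {m} (S : Vec Bool m) F b U r → term (b ∷ S) F (b ∷ U) r ≡ term S (F ∘ (b ∷_)) U r
  keep S F b U r rewrite diff-eq S U b | allᶠ-suc (λ i → lookup (b ∷ U) i ⇒ᵇ lookup (b ∷ S) i) with b
  ... | false = refl
  ... | true  = refl

  lower : ∀ {m} (S : Vec Bool m) F U r →
         term (true ∷ S) F (false ∷ U) r ≡ term S (λ U → - F (false ∷ U)) U r
  lower S F U r rewrite tabulate-filter (λ i → lookup (true ∷ S) i ∧ not (lookup (false ∷ U) i)) suc
    | allᶠ-suc (λ i → lookup (false ∷ U) i ⇒ᵇ lookup (true ∷ S) i) with sub U S
  ... | false = refl
  ... | true  = cong (ℤ._+ r)
    (solve 2 (λ a b → (:- a) :* b := a :* (:- b)) refl (sign P (diff S U)) (F (false ∷ U)))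
    where open +-*-Solver

  drop : ∀ {m} (S : Vec Bool m) F U r → term (false ∷ S) F (true ∷ U) r ≡ r
  drop S F U r rewrite allᶠ-suc (λ i → lookup (true ∷ U) i ⇒ᵇ lookup (false ∷ S) i) = refl

  split : ∀ {m} (f : Vec Bool (suc m) → ℤ → ℤ) z → foldr f z (allSubsets (suc m))
          ≡ foldr (f ∘ (true ∷_)) (foldr (f ∘ (false ∷_)) z (allSubsets m)) (allSubsets m)
  split {m} f z = trans (foldr-++ f z (map (true ∷_) (allSubsets m)) _)
    (trans (cong (λ w → foldr f w (map (true ∷_) (allSubsets m))) (foldr-map f (false ∷_) z (allSubsets m)))
      (foldr-map f (true ∷_) _ (allSubsets m)))

  go : ∀ {m} (S : Vec Bool m) F z → foldr (term S F) z (allSubsets m) ≡ alt S F ℤ.+ z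
  go []          F z = cong (ℤ._+ z) (ℤ.*-identityˡ (F []))
  go {suc m} (true ∷ S)  F z = begin
    foldr (term (true ∷ S) F) z (allSubsets (suc m))
      ≡⟨ split (term (true ∷ S) F) z ⟩
    foldr _ (foldr (term (true ∷ S) F ∘ (false ∷_)) z (allSubsets m)) (allSubsets m)
      ≡⟨ foldr-cong (keep S F true) refl (allSubsets m) ⟩
    foldr _ (foldr (term (true ∷ S) F ∘ (false ∷_)) z (allSubsets m)) (allSubsets m)
      ≡⟨ go S _ _ ⟩
    alt S (F ∘ (true ∷_)) ℤ.+ foldr (term (true ∷ S) F ∘ (false ∷_)) z (allSubsets m)
      ≡⟨ cong (λ w → alt S (F ∘ (true ∷_)) ℤ.+ w) (trans (foldr-cong (lower S F) refl (allSubsets m)) (go S _ z)) ⟩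
    alt S (F ∘ (true ∷_)) ℤ.+ (alt S (λ U → - F (false ∷ U)) ℤ.+ z)
      ≡⟨ ℤ.+-assoc (alt S (F ∘ (true ∷_))) _ z ⟨
    alt S (F ∘ (true ∷_)) ℤ.+ alt S (λ U → - F (false ∷ U)) ℤ.+ z
      ≡⟨ cong (λ w → alt S (F ∘ (true ∷_)) ℤ.+ w ℤ.+ z) (alt-neg S _) ⟩
    alt (true ∷ S) F ℤ.+ z ∎
    where open ≡-Reasoning
  go {suc m} (false ∷ S) F z = begin
    foldr (term (false ∷ S) F) z (allSubsets (suc m))
      ≡⟨ split (term (false ∷ S) F) z ⟩
    foldr _ (foldr (term (false ∷ S) F ∘ (false ∷_)) z (allSubsets m)) (allSubsets m)
      ≡⟨ foldr-cong (drop S F) refl (allSubsets m) ⟩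
    foldr _ (foldr (term (false ∷ S) F ∘ (false ∷_)) z (allSubsets m)) (allSubsets m)
      ≡⟨ foldr-skip _ (allSubsets m) ⟩
    foldr (term (false ∷ S) F ∘ (false ∷_)) z (allSubsets m)
      ≡⟨ foldr-cong (keep S F false) refl (allSubsets m) ⟩
    foldr _ z (allSubsets m)
      ≡⟨ go S _ z ⟩
    alt (false ∷ S) F ℤ.+ z ∎
    where open ≡-Reasoning

-- Counting chains rank by rank

count : ∀ {m} → (Vec Bool m → Bool) → ℕ
count {m} p = length (filterᵇ p (allSubsets m))

count-cong : ∀ {m} {p q : Vec Bool m → Bool} → (∀ C → p C ≡ q C) → count p ≡ count q
count-cong {m} {p} {q} h = go (allSubsets m)
  where
  go : ∀ xs → length (filterᵇ p xs) ≡ length (filterᵇ q xs)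
  go []       = refl
  go (x ∷ xs) rewrite h x with q x
  ... | true  = cong suc (go xs)
  ... | false = go xs

count-∷ : ∀ {m} (p : Vec Bool (suc m) → Bool) → count p ≡ count (p ∘ (true ∷_)) ℕ.+ count (p ∘ (false ∷_))
count-∷ {m} p = begin
  length (filterᵇ p (map (true ∷_) xs ++ map (false ∷_) xs))
    ≡⟨ cong length (filter-++ (T? ∘ p) (map (true ∷_) xs) _) ⟩
  length (filterᵇ p (map (true ∷_) xs) ++ filterᵇ p (map (false ∷_) xs))
    ≡⟨ length-++ (filterᵇ p (map (true ∷_) xs)) ⟩
  length (filterᵇ p (map (true ∷_) xs)) ℕ.+ length (filterᵇ p (map (false ∷_) xs))
    ≡⟨ cong₂ ℕ._+_ (pull (true ∷_) xs) (pull (false ∷_) xs) ⟩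
  count (p ∘ (true ∷_)) ℕ.+ count (p ∘ (false ∷_)) ∎
  where
  open ≡-Reasoning
  xs = allSubsets m
  pull : ∀ (f : Vec Bool m → Vec Bool (suc m)) ys → length (filterᵇ p (map f ys)) ≡ length (filterᵇ (p ∘ f) ys)
  pull f []       = refl
  pull f (y ∷ ys) with p (f y)
  ... | true  = cong suc (pull f ys)
  ... | false = pull f ys

count-false : ∀ m → count {m} (λ _ → false) ≡ 0
count-false m = go (allSubsets m)
  where
  go : ∀ (xs : List (Vec Bool m)) → length (filterᵇ (λ _ → false) xs) ≡ 0
  go []       = refl
  go (x ∷ xs) = go xs

-- The nonempty sets of labels. The empty set never arises, because every label has an upper
-- neighbour (`graph-total`).
data Sub : Set where
  only : Bool → Sub
  both : Sub

mem : Bool → Sub → Bool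
mem t (only u) = not (t xor u)
mem t both     = true

image : ∀ {q q′} → Edge q q′ → Sub → Sub
image e    both         = both
image full (only s)     = both
image par  V            = V
image parᵒ V            = V
image zig  (only false) = both
image zig  (only true)  = only true
image zigˡ (only false) = both
image zigˡ (only true)  = only true
image zigʳ (only false) = only true
image zigʳ (only true)  = both

mem-only : ∀ t u → T (mem t (only u)) → t ≡ u
mem-only false false h = refl
mem-only true  true  h = refl

only-mem : ∀ t → T (mem t (only t))
only-mem false = tt
only-mem true  = tt

image-elim : ∀ {q q′} (e : Edge q q′) V t → T (mem t (image e V)) → Σ Bool λ s → T (mem s V) × T (graph e s t)
image-elim e    both         t     h = let s , a = graph-onto e t in s , tt , a
image-elim full (only s)     t     h = s , only-mem s , tt
image-elim par  (only s)     t     h with refl ← mem-only t s h = s , h , h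
image-elim parᵒ (only s)     t     h with refl ← mem-only t s h = s , h , h
image-elim zig  (only false) t     h = false , tt , tt
image-elim zig  (only true)  t     h with refl ← mem-only t true h = true , tt , tt
image-elim zigˡ (only false) t     h = false , tt , tt
image-elim zigˡ (only true)  t     h with refl ← mem-only t true h = true , tt , tt
image-elim zigʳ (only false) t     h with refl ← mem-only t true h = false , tt , tt
image-elim zigʳ (only true)  t     h = true , tt , tt

image-intro : ∀ {q q′} (e : Edge q q′) V s t → T (mem s V) → T (graph e s t) → T (mem t (image e V))
image-intro e    both         s t a b = tt
image-intro full (only u)     s t a b = tt
image-intro par  (only u)     s t a b with refl ← mem-only s u a | refl ← mem-only s t b = only-mem s
image-intro parᵒ (only u)     s t a b with refl ← mem-only s u a | refl ← mem-only s t b = only-mem s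
image-intro zig  (only false) s t a b = tt
image-intro zig  (only true)  true true a b = tt
image-intro zigˡ (only false) s t a b = tt
image-intro zigˡ (only true)  true true a b = tt
image-intro zigʳ (only false) false true a b = tt
image-intro zigʳ (only true)  s t a b = tt

over : Sub → (Sub → ℕ) → ℕ
over (only b) f = f (only b)
over both     f = f (only false) ℕ.+ f (only true)

-- The number of chains of c with rank set s lying in the filter generated by V.
chains : ∀ {q n k} → Code q n k → Sub → (ℕ → Bool) → ℕ
chains nil       V s = 1
chains (one c)   V s = chains c both (s ∘ suc)
chains (two e c) V s = if s 0 then over (image e V) (λ W → chains c W (s ∘ suc))
                              else chains c (image e V) (s ∘ suc)

-- The elements of a pair are incomparable. If the rank is selected, a chain takes exactly one of
-- them; it must lie in the current filter and generates the next one. Otherwise it takes neither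
-- and the filter stays as it is.
pick : Bool → Bool → Bool → Sub → (Sub → Bool) → Bool
pick false false false V g = g V
pick true  true  false V g = mem false V ∧ g (only false)
pick true  false true  V g = mem true V ∧ g (only true)
pick _     _     _     V g = false

-- A characteristic vector is read rank by rank. A single point is taken exactly when its rank is
-- selected. Either way all later elements lie above it, and its two labels coincide, so the filter
-- restarts at `both`.
isChain : ∀ {q n k} → Code q n k → Sub → (ℕ → Bool) → Vec Bool k → Bool
isChain nil       V s []          = true
isChain (one c)   V s (p ∷ C)     = not (s 0 xor p) ∧ isChain c both (s ∘ suc) C
isChain (two e c) V s (p ∷ q ∷ C) = pick (s 0) p q (image e V) (λ W → isChain c W (s ∘ suc) C)

count-pick : ∀ {m} b V (g : Sub → Vec Bool m → Bool) (f : Vec Bool (suc (suc m)) → Bool) →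
             (∀ p q C → f (p ∷ q ∷ C) ≡ pick b p q V (λ W → g W C)) →
             count f ≡ (if b then over V (count ∘ g) else count (g V))
count-pick {m} b V g f h = begin
  count f ≡⟨ count-∷ f ⟩
  count (f ∘ (true ∷_)) ℕ.+ count (f ∘ (false ∷_))
    ≡⟨ cong₂ ℕ._+_ (count-∷ (f ∘ (true ∷_))) (count-∷ (f ∘ (false ∷_))) ⟩
  _ ≡⟨ cong₂ ℕ._+_ (cong₂ ℕ._+_ (count-cong (h true true)) (count-cong (h true false)))
                   (cong₂ ℕ._+_ (count-cong (h false true)) (count-cong (h false false))) ⟩
  (count (picked b V true true) ℕ.+ count (picked b V true false))
    ℕ.+ (count (picked b V false true) ℕ.+ count (picked b V false false))
    ≡⟨ go b V ⟩
  (if b then over V (count ∘ g) else count (g V)) ∎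
  where
  open ≡-Reasoning
  picked : Bool → Sub → Bool → Bool → Vec Bool m → Bool
  picked b V p q C = pick b p q V (λ W → g W C)
  go : ∀ b V →
    (count (picked b V true true) ℕ.+ count (picked b V true false))
      ℕ.+ (count (picked b V false true) ℕ.+ count (picked b V false false))
    ≡ (if b then over V (count ∘ g) else count (g V))
  go false V           rewrite count-false m = refl
  go true (only false) rewrite count-false m = ℕ.+-identityʳ _
  go true (only true)  rewrite count-false m = ℕ.+-identityʳ _
  go true both         rewrite count-false m = cong (count (g (only false)) ℕ.+_) (ℕ.+-identityʳ _)

count-isChain : ∀ {q n k} (c : Code q n k) V s → count (isChain c V s) ≡ chains c V s
count-isChain nil       V s = refl
count-isChain d@(one {k = k} c) V s = trans (count-∷ (isChain d V s)) go
  where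
  go : count (isChain d V s ∘ (true ∷_)) ℕ.+ count (isChain d V s ∘ (false ∷_))
       ≡ chains c both (s ∘ suc)
  go with s 0
  ... | true  rewrite count-false k = trans (ℕ.+-identityʳ _) (count-isChain c both (s ∘ suc))
  ... | false rewrite count-false k = count-isChain c both (s ∘ suc)
count-isChain (two e c) V s = trans
  (count-pick (s 0) (image e V) (λ W → isChain c W (s ∘ suc)) (isChain (two e c) V s) (λ p q C → refl)) go
  where
  over-cong : ∀ V {f g : Sub → ℕ} → (∀ W → f W ≡ g W) → over V f ≡ over V g
  over-cong (only b) h = h (only b)
  over-cong both     h = cong₂ ℕ._+_ (h (only false)) (h (only true))
  go : (if s 0 then over (image e V) (λ W → count (isChain c W (s ∘ suc))) else count (isChain c (image e V) (s ∘ suc)))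
       ≡ chains (two e c) V s
  go with s 0
  ... | true  = over-cong (image e V) λ W → count-isChain c W (s ∘ suc)
  ... | false = count-isChain c (image e V) (s ∘ suc)

-- Padding with `false` uncouples the length of `S` from the number of ranks of a code; for
-- `S : RankSet n` it leaves the top rank unselected.
bits : ∀ {m} → Vec Bool m → ℕ → Bool
bits []      j       = false
bits (b ∷ S) zero    = b
bits (b ∷ S) (suc j) = bits S j

-- Flag h-vectors of codes take only the values 0, 1, -1

Small : ℤ → Set
Small z = (z ≡ + 0) ⊎ ((z ≡ + 1) ⊎ (z ≡ - + 1))

small-neg : ∀ {z} → Small z → Small (- z)
small-neg (inj₁ refl)        = inj₁ refl
small-neg (inj₂ (inj₁ refl)) = inj₂ (inj₂ refl)
small-neg (inj₂ (inj₂ refl)) = inj₂ (inj₁ refl)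

flagH : ∀ {q n k m} → Code q n k → Sub → Vec Bool m → ℤ
flagH c V S = alt S (λ U → + chains c V (bits U))

-- By `flagH-two-true` this is the value that arises once the rank of the pair itself is selected.
defect : ∀ {q n k m} → Code q n k → Vec Bool m → ℤ
defect c S = flagH c (only false) S ℤ.+ flagH c (only true) S - flagH c both S

peak : ∀ {q n k m} → Code q n k → Vec Bool m → Sub → ℤ
peak c S (only _) = + 0
peak c S both     = defect c S

-- The chains through the selected rank are compared with those skipping it. Over a one-element
-- image both counts are the chains above that element and cancel; over a two-element image the two
-- choices add up, and `defect` remains.
flagH-two-true : ∀ {q q′ n k m} (e : Edge q q′) (c : Code q′ n k) V (S : Vec Bool m) →
             flagH (two e c) V (true ∷ S) ≡ peak c S (image e V)
flagH-two-true e c V S with image e V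
... | only x = ℤ.+-inverseʳ (flagH c (only x) S)
... | both   = cong (_- flagH c both S) (trans (alt-cong S λ U → ℤ.pos-+ (chains c (only false) (bits U)) _) (alt-+ S _ _))

chains-empty : ∀ {q n k} (c : Code q n k) V → chains c V (bits []) ≡ 1
chains-empty nil       V = refl
chains-empty (one c)   V = chains-empty c both
chains-empty (two e c) V = chains-empty c (image e V)

x+y-x : ∀ x y → x ℤ.+ y - x ≡ y
x+y-x x y = solve 2 (λ x y → x :+ y :- x := y) refl x y
  where open +-*-Solver

x+y-y : ∀ x y → x ℤ.+ y - y ≡ x
x+y-y x y = solve 2 (λ x y → x :+ y :- y := x) refl x y
  where open +-*-Solver

-- Every quantity of the lower rank reduces, up to sign, to a single quantity of the upper rank or
-- to 0. For the defect this is a cancellation: under `full` all three images are `both`, under a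
-- path the image of one label is `both` and cancels against the image of the pair, and under a
-- matching the images are the labels themselves, so that a selected rank contributes 0 + 0 minus
-- the upper defect.
flagH-small : ∀ {q n k m} (c : Code q n k) (S : Vec Bool m) → (∀ V → Small (flagH c V S)) × Small (defect c S)
flagH-small c [] rewrite chains-empty c (only false) | chains-empty c (only true) | chains-empty c both =
  (λ V → inj₂ (inj₁ (cong +_ (chains-empty c V)))) , inj₂ (inj₁ refl)
flagH-small nil S = (λ V → const S) , subst Small (sym (x+y-x (flagH nil both S) (flagH nil both S))) (const S)
  where
  const : ∀ {m} (S : Vec Bool m) → Small (alt S (λ _ → + 1))
  const []          = inj₂ (inj₁ refl)
  const (true ∷ S)  = inj₁ (ℤ.+-inverseʳ (alt S (λ _ → + 1)))
  const (false ∷ S) = const S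
-- Taking the single point or leaving it out gives equally many chains, so a selected rank of size
-- one annihilates the alternating sum.
flagH-small (one c) (true ∷ S) rewrite ℤ.+-inverseʳ (flagH c both S) = (λ V → inj₁ refl) , inj₁ refl
flagH-small (one c) (false ∷ S) =
  (λ V → proj₁ (flagH-small c S) both) , subst Small (sym (x+y-x (flagH c both S) (flagH c both S))) (proj₁ (flagH-small c S) both)
flagH-small (two e c) (true ∷ S) = (λ V → subst Small (sym (flagH-two-true e c V S)) (peak-small (image e V))) , go
  where
  peak-small : ∀ V → Small (peak c S V)
  peak-small (only x) = inj₁ refl
  peak-small both     = proj₂ (flagH-small c S)
  peaks : ∀ {q q′} (e : Edge q q′) →
          Small (peak c S (image e (only false)) ℤ.+ peak c S (image e (only true)) - peak c S (image e both))
  peaks full = subst Small (sym (x+y-x (defect c S) (defect c S))) (peak-small both)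
  peaks par  = subst Small (sym (ℤ.+-identityˡ _)) (small-neg (peak-small both))
  peaks parᵒ = subst Small (sym (ℤ.+-identityˡ _)) (small-neg (peak-small both))
  peaks zig  = inj₁ (x+y-x (defect c S) (+ 0))
  peaks zigˡ = inj₁ (x+y-x (defect c S) (+ 0))
  peaks zigʳ = inj₁ (x+y-y (+ 0) (defect c S))
  go : Small (defect (two e c) (true ∷ S))
  go rewrite flagH-two-true e c (only false) S | flagH-two-true e c (only true) S | flagH-two-true e c both S = peaks e
flagH-small (two e c) (false ∷ S) = (λ V → s (image e V)) , go e
  where
  s = proj₁ (flagH-small c S)
  go : ∀ {q q′} (e : Edge q q′) → Small (flagH c (image e (only false)) S ℤ.+ flagH c (image e (only true)) S - flagH c (image e both) S)
  go full = subst Small (sym (x+y-x (flagH c both S) (flagH c both S))) (s both)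
  go par  = proj₂ (flagH-small c S)
  go parᵒ = proj₂ (flagH-small c S)
  go zig  = subst Small (sym (x+y-x (flagH c both S) (flagH c (only true) S))) (s (only true))
  go zigˡ = subst Small (sym (x+y-x (flagH c both S) (flagH c (only true) S))) (s (only true))
  go zigʳ = subst Small (sym (x+y-y (flagH c (only true) S) (flagH c both S))) (s (only true))

-- Subsets that are chains with a prescribed rank set

infix 4 _∈_
_∈_ : ∀ {k} → Fin k → Vec Bool k → Set
x ∈ C = T (lookup C x)

-- The declarative counterpart of `isChain`. The field `above` confines the chain to the filter
-- generated by `V`, which lets the property pass to the tail of a code; for `both` it always holds,
-- by `rel-onto`.
record IsChain {q n k} (c : Code q n k) (V : Sub) (s : ℕ → Bool) (C : Vec Bool k) : Set where
  constructor mk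
  field
    above  : ∀ x → x ∈ C → Σ Bool λ u → T (mem u V) × T (rel c u x)
    linear : ∀ x y → x ∈ C → y ∈ C → T (le c x y) ⊎ T (le c y x)
    within : ∀ x → x ∈ C → T (s (rk c x))
    onto   : ∀ j → T (s j) → Σ (Fin k) λ x → x ∈ C × rk c x ≡ j
open IsChain

one-sound : ∀ {q n k} (c : Code point n k) V s p C → s 0 ≡ p →
            IsChain c both (s ∘ suc) C → IsChain (one {q = q} c) V s (p ∷ C)
one-sound {q} c V s p C s≡p h = mk ab li wi on
  where
  d = one {q = q} c
  bottom : ∀ x → x ∈ C → T (rel c false x)
  bottom x m = subst T (rel-point c _ x) (proj₂ (proj₂ (above h x m)))
  rep : ∀ V → Σ Bool λ u → T (mem u V)
  rep (only b) = b , only-mem b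
  rep both     = true , tt
  ab : ∀ x → x ∈ (p ∷ C) → Σ Bool λ u → T (mem u V) × T (rel d u x)
  ab zero    m = let u , a = rep V in u , a , tt
  ab (suc x) m = let u , a = rep V in u , a , bottom x m
  li : ∀ x y → x ∈ (p ∷ C) → y ∈ (p ∷ C) → T (le d x y) ⊎ T (le d y x)
  li zero    zero    m m′ = inj₁ tt
  li zero    (suc y) m m′ = inj₁ (bottom y m′)
  li (suc x) zero    m m′ = inj₂ (bottom x m)
  li (suc x) (suc y) m m′ = linear h x y m m′
  wi : ∀ x → x ∈ (p ∷ C) → T (s (rk d x))
  wi zero    m = subst T (sym s≡p) m
  wi (suc x) m = within h x m
  on : ∀ j → T (s j) → Σ (Fin _) λ x → x ∈ (p ∷ C) × rk d x ≡ j
  on zero    m = zero , subst T s≡p m , refl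
  on (suc j) m = let x , a , e = onto h j m in suc x , a , cong suc e

skip-sound : ∀ {q q′ n k} (e : Edge q q′) (c : Code q′ n k) V s C → s 0 ≡ false →
             IsChain c (image e V) (s ∘ suc) C → IsChain (two e c) V s (false ∷ false ∷ C)
skip-sound {k = k} e c V s C s0 h = mk ab li wi on
  where
  D = false ∷ false ∷ C
  ab : ∀ x → x ∈ D → Σ Bool λ u → T (mem u V) × T (rel (two e c) u x)
  ab (suc zero) ()
  ab (suc (suc x)) m =
    let t , a , r = above h x m
        u , v , g = image-elim e V t a
    in u , v , two-rel e c u t x g r
  li : ∀ x y → x ∈ D → y ∈ D → T (le (two e c) x y) ⊎ T (le (two e c) y x)
  li (suc zero)    y             ()
  li (suc (suc x)) (suc zero)    m ()
  li (suc (suc x)) (suc (suc y)) m m′ = linear h x y m m′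
  wi : ∀ x → x ∈ D → T (s (rk (two e c) x))
  wi (suc zero) ()
  wi (suc (suc x)) m = within h x m
  on : ∀ j → T (s j) → Σ (Fin _) λ x → x ∈ D × rk (two e c) x ≡ j
  on zero    m = ⊥-elim (subst T s0 m)
  on (suc j) m = let x , a , r = onto h j m in suc (suc x) , a , cong suc r

pick-sound : ∀ {q q′ n k} (e : Edge q q′) (c : Code q′ n k) V s t C D → T (s 0) → T (mem t (image e V)) →
             IsChain c (only t) (s ∘ suc) C → side t ∈ D → (∀ y → y ∈ C → suc (suc y) ∈ D) →
             (∀ x → x ∈ D → x ≡ side t ⊎ Σ (Fin k) λ y → x ≡ suc (suc y) × y ∈ C) →
             IsChain (two e c) V s D
pick-sound {k = k} e c V s t C D s0 t∈ h t∈D C⊆D view = mk ab li wi on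
  where
  u = proj₁ (image-elim e V t t∈)
  u∈ = proj₁ (proj₂ (image-elim e V t t∈))
  g = proj₂ (proj₂ (image-elim e V t t∈))
  above-t : ∀ y → y ∈ C → T (rel c t y)
  above-t y m = let v , a , r = above h y m in subst (λ v → T (rel c v y)) (mem-only v t a) r
  rk-side : ∀ t → rk (two e c) (side t) ≡ 0
  rk-side false = refl
  rk-side true  = refl
  ab : ∀ x → x ∈ D → Σ Bool λ u → T (mem u V) × T (rel (two e c) u x)
  ab x m with view x m
  ... | inj₁ refl           = u , u∈ , subst T (sym (rel-side e c u t)) g
  ... | inj₂ (y , refl , a) = u , u∈ , two-rel e c u t y g (above-t y a)
  li : ∀ x y → x ∈ D → y ∈ D → T (le (two e c) x y) ⊎ T (le (two e c) y x)
  li x y m m′ with view x m | view y m′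
  ... | inj₁ refl           | inj₁ refl            = inj₁ (le-refl (two e c) (side t))
  ... | inj₁ refl           | inj₂ (y , refl , a)  = inj₁ (subst T (sym (le-side e c t y)) (above-t y a))
  ... | inj₂ (x , refl , a) | inj₁ refl            = inj₂ (subst T (sym (le-side e c t x)) (above-t x a))
  ... | inj₂ (x , refl , a) | inj₂ (y , refl , a′) = linear h x y a a′
  wi : ∀ x → x ∈ D → T (s (rk (two e c) x))
  wi x m with view x m
  ... | inj₁ refl           = subst (T ∘ s) (sym (rk-side t)) s0
  ... | inj₂ (y , refl , a) = within h y a
  on : ∀ j → T (s j) → Σ (Fin _) λ x → x ∈ D × rk (two e c) x ≡ j
  on zero    m = side t , t∈D , rk-side t
  on (suc j) m = let x , a , r = onto h j m in suc (suc x) , C⊆D x a , cong suc r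

-- The bound on `s` provides `onto`: at `nil` the test accepts every `s`, although a rank selected
-- beyond the end of the code is met by no element.
isChain-sound : ∀ {q n k} (c : Code q n k) V s C → (∀ j → T (s j) → j < n) →
                T (isChain c V s C) → IsChain c V s C
isChain-sound nil V s [] bd h = mk (λ ()) (λ ()) (λ ()) λ j m → ⊥-elim (ℕ.n≮0 (bd j m))
isChain-sound (one c) V s (p ∷ C) bd h =
  let a , r = ∧-elim {not (s 0 xor p)} h
  in one-sound c V s p C (mem-only (s 0) p a) (isChain-sound c both (s ∘ suc) C (λ j m → ℕ.s≤s⁻¹ (bd (suc j) m)) r)
isChain-sound (two e c) V s (p ∷ q ∷ C) bd h = go (s 0) refl p q h
  where
  rec : ∀ W → T (isChain c W (s ∘ suc) C) → IsChain c W (s ∘ suc) C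
  rec W = isChain-sound c W (s ∘ suc) C (λ j m → ℕ.s≤s⁻¹ (bd (suc j) m))
  go : ∀ b → s 0 ≡ b → ∀ p q → T (pick b p q (image e V) (λ W → isChain c W (s ∘ suc) C)) →
       IsChain (two e c) V s (p ∷ q ∷ C)
  go false s0 false false h = skip-sound e c V s C s0 (rec _ h)
  go true  s0 true  false h =
    let a , r = ∧-elim {mem false (image e V)} h
    in pick-sound e c V s false C _ (subst T (sym s0) tt) a (rec _ r) tt (λ _ m → m)
         λ { zero m → inj₁ refl ; (suc zero) () ; (suc (suc x)) m → inj₂ (x , refl , m) }
  go true  s0 false true  h =
    let a , r = ∧-elim {mem true (image e V)} h
    in pick-sound e c V s true C _ (subst T (sym s0) tt) a (rec _ r) tt (λ _ m → m)
         λ { zero () ; (suc zero) m → inj₁ refl ; (suc (suc x)) m → inj₂ (x , refl , m) }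

isChain-complete : ∀ {q n k} (c : Code q n k) V s C → IsChain c V s C → T (isChain c V s C)
isChain-complete nil V s [] h = tt
isChain-complete (one c) V s (p ∷ C) h = ∧-intro {not (s 0 xor p)} (subst (λ b → T (not (s 0 xor b))) s0 (only-mem (s 0)))
  (isChain-complete c both (s ∘ suc) C (mk (λ x _ → let u , r = rel-onto c x in u , tt , r)
    (λ x y → linear h (suc x) (suc y)) (λ x → within h (suc x)) on))
  where
  s0 : s 0 ≡ p
  s0 = T-ext (λ m → at-zero (onto h 0 m)) (within h zero)
    where
    at-zero : (Σ (Fin _) λ x → x ∈ (p ∷ C) × rk (one c) x ≡ 0) → T p
    at-zero (zero , m , _) = m
  on : ∀ j → T (s (suc j)) → Σ (Fin _) λ x → x ∈ C × rk c x ≡ j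
  on j m with onto h (suc j) m
  ... | suc x , a , r = x , a , ℕ.suc-injective r
isChain-complete (two e c) V s (p ∷ q ∷ C) h = go (s 0) refl p q h
  where
  tail : ∀ {p q} W → IsChain (two e c) V s (p ∷ q ∷ C) →
         (∀ x → x ∈ C → Σ Bool λ u → T (mem u W) × T (rel c u x)) → T (isChain c W (s ∘ suc) C)
  tail {p} {q} W h ab = isChain-complete c W (s ∘ suc) C
    (mk ab (λ x y → linear h (suc (suc x)) (suc (suc y))) (λ x → within h (suc (suc x))) on)
    where
    on : ∀ j → T (s (suc j)) → Σ (Fin _) λ x → x ∈ C × rk c x ≡ j
    on j m with onto h (suc j) m
    ... | suc zero , a , ()
    ... | suc (suc x) , a , r = x , a , ℕ.suc-injective r

  go : ∀ b → s 0 ≡ b → ∀ p q → IsChain (two e c) V s (p ∷ q ∷ C) →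
       T (pick b p q (image e V) (λ W → isChain c W (s ∘ suc) C))
  go false s0 true  q     h = ⊥-elim (subst T s0 (within h zero tt))
  go false s0 false true  h = ⊥-elim (subst T s0 (within h (suc zero) tt))
  go false s0 false false h = tail _ h λ x m →
    let u , v , r = above h (suc (suc x)) m
        t , g , r′ = rel-two e c u x r
    in t , image-intro e V u t v g , r′
  go true  s0 true  true  h with linear h zero (suc zero) tt tt
  ... | inj₁ ()
  ... | inj₂ ()
  go true  s0 false false h with onto h 0 (subst T (sym s0) tt)
  ... | suc zero , () , _
  ... | suc (suc x) , _ , ()
  go true  s0 true  false h =
    let u , v , g = above h zero tt
    in ∧-intro {mem false (image e V)} (image-intro e V u false v g)
         (tail _ h λ x m → false , tt , up (linear h zero (suc (suc x)) tt m))
    where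
    up : ∀ {x} → T (rel c false x) ⊎ T (le (two e c) (suc (suc x)) zero) → T (rel c false x)
    up (inj₁ r) = r
  go true  s0 false true  h =
    let u , v , g = above h (suc zero) tt
    in ∧-intro {mem true (image e V)} (image-intro e V u true v g)
         (tail _ h λ x m → true , tt , up (linear h (suc zero) (suc (suc x)) tt m))
    where
    up : ∀ {x} → T (rel c true x) ⊎ T (le (two e c) (suc (suc x)) (suc zero)) → T (rel c true x)
    up (inj₁ r) = r

bits-elim : ∀ {m} (S : Vec Bool m) j → T (bits S j) → Σ (Fin m) λ i → i ∈ S × j ≡ toℕ i
bits-elim (b ∷ S) zero    h = zero , h , refl
bits-elim (b ∷ S) (suc j) h = let i , a , r = bits-elim S j h in suc i , a , cong suc r

bits-intro : ∀ {m} (S : Vec Bool m) i → i ∈ S → T (bits S (toℕ i))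
bits-intro (b ∷ S) zero    h = h
bits-intro (b ∷ S) (suc i) h = bits-intro S i h

α-code : ∀ {n k} (c : Code point n k) (S : RankSet n) → α (codeGraded c) S ≡ chains c both (bits S)
α-code {n} {k} c S = trans (count-cong λ C → T-ext (to C) (from C)) (count-isChain d both s)
  where
  P = codeGraded c
  d = one {q = point} c
  -- Index `i` of `S` stands for rank `i + 1`; the prepended `false` is the unselected rank of the
  -- bottom.
  s = bits (false ∷ S)
  rank∈ : ℕ → Fin (n ∸ 1) → Bool
  rank∈ r i = lookup S i ∧ (r ≡ᵇ suc (toℕ i))
  s-intro : ∀ r i → T (rank∈ r i) → T (s r)
  s-intro r i t = let a , e = ∧-elim {lookup S i} t in
    subst (T ∘ s) (sym (ℕ.≡ᵇ⇒≡ r (suc (toℕ i)) e)) (bits-intro S i a)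
  s-elim : ∀ r → T (s r) → Σ (Fin (n ∸ 1)) λ i → i ∈ S × r ≡ suc (toℕ i)
  s-elim (suc r) t = let i , a , e = bits-elim S r t in i , a , cong suc e
  bound : ∀ j → T (s j) → j < suc n
  bound j t with s-elim j t
  ... | i , _ , refl = s≤s (ℕ.<-≤-trans (toℕ<n i) (ℕ.m∸n≤m n 1))

  to : ∀ C → T (isChainᵇ P C ∧ rankSetIsᵇ P S C) → T (isChain d both s C)
  to C h =
    let ch , rs = ∧-elim {isChainᵇ P C} h
        r₁ , r₂ = ∧-elim {allᶠ (λ x → lookup C x ⇒ᵇ anyᶠ (rank∈ (rk d x)))} rs
    in isChain-complete d both s C (mk
      (λ x _ → let u , r = rel-onto d x in u , tt , r)
      (λ x y a b → ∨-elim {le d x y} (⇒-elim {lookup C x ∧ lookup C y}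
        (allᶠ-elim {p = λ y → (lookup C x ∧ lookup C y) ⇒ᵇ (le d x y ∨ le d y x)}
          (allᶠ-elim {p = λ x → allᶠ λ y → (lookup C x ∧ lookup C y) ⇒ᵇ (le d x y ∨ le d y x)} ch x) y)
        (∧-intro a b)))
      (λ x a → let i , t = anyᶠ-elim (rank∈ (rk d x)) (⇒-elim {lookup C x}
                     (allᶠ-elim {p = λ x → lookup C x ⇒ᵇ anyᶠ (rank∈ (rk d x))} r₁ x) a)
               in s-intro (rk d x) i t)
      (λ j t → let i , a , e = s-elim j t
                   x , u = anyᶠ-elim (λ x → lookup C x ∧ (rk d x ≡ᵇ suc (toℕ i))) (⇒-elim {lookup S i}
                     (allᶠ-elim {p = λ i → lookup S i ⇒ᵇ anyᶠ (λ x → lookup C x ∧ (rk d x ≡ᵇ suc (toℕ i)))} r₂ i) a)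
                   v , w = ∧-elim {lookup C x} u
               in x , v , trans (ℕ.≡ᵇ⇒≡ (rk d x) _ w) (sym e)))

  from : ∀ C → T (isChain d both s C) → T (isChainᵇ P C ∧ rankSetIsᵇ P S C)
  from C h = ∧-intro {isChainᵇ P C}
    (allᶠ-intro {p = λ x → allᶠ λ y → (lookup C x ∧ lookup C y) ⇒ᵇ (le d x y ∨ le d y x)} λ x →
      allᶠ-intro {p = λ y → (lookup C x ∧ lookup C y) ⇒ᵇ (le d x y ∨ le d y x)} λ y →
      ⇒-intro {lookup C x ∧ lookup C y} λ m → let a , b = ∧-elim {lookup C x} m in ∨-intro (linear H x y a b))
    (∧-intro {allᶠ (λ x → lookup C x ⇒ᵇ anyᶠ (rank∈ (rk d x)))}
      (allᶠ-intro {p = λ x → lookup C x ⇒ᵇ anyᶠ (rank∈ (rk d x))} λ x → ⇒-intro {lookup C x} λ m →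
        let i , a , e = s-elim (rk d x) (within H x m)
        in anyᶠ-intro (rank∈ (rk d x)) i (∧-intro {lookup S i} a (ℕ.≡⇒≡ᵇ _ _ e)))
      (allᶠ-intro {p = λ i → lookup S i ⇒ᵇ anyᶠ (λ x → lookup C x ∧ (rk d x ≡ᵇ suc (toℕ i)))} λ i → ⇒-intro {lookup S i} λ m →
        let x , a , e = onto H (suc (toℕ i)) (bits-intro S i m)
        in anyᶠ-intro (λ x → lookup C x ∧ (rk d x ≡ᵇ suc (toℕ i))) x (∧-intro {lookup C x} a (ℕ.≡⇒≡ᵇ _ _ e))))
    where
    H = isChain-sound d both s C bound h
    ∨-intro : ∀ {a b} → T a ⊎ T b → T (a ∨ b)
    ∨-intro {true}          _        = tt
    ∨-intro {false} {true}  _        = tt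
    ∨-intro {false} {false} (inj₁ ())
    ∨-intro {false} {false} (inj₂ ())

code-multiplicityFree : ∀ {n k} (c : Code point n k) → MultiplicityFree (codeGraded c)
code-multiplicityFree c S = subst Small
  (sym (trans (β≡alt (codeGraded c) S) (alt-cong S λ U → cong +_ (α-code c U))))
  (proj₁ (flagH-small c S) both)

-- Graded posets

module Graded {n k} (P : GradedPoset n k) where
  open GradedPoset P
  open Strict poset

  _⊏_ : Fin k → Fin k → Set
  x ⊏ y = T (x ≺ y)

  ⊏-≼-trans : ∀ {x y z} → x ⊏ y → T (y ≼ z) → x ⊏ z
  ⊏-≼-trans {x} {y} {z} p r = let x≼y , x≢y = ≺-elim p in
    ≺-intro (transitive x y z x≼y r) λ { refl → x≢y (antisym x y x≼y r) }

  ⊏-isStrictPartialOrder : IsStrictPartialOrder _≡_ _⊏_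
  ⊏-isStrictPartialOrder = record
    { isEquivalence = isEquivalence
    ; irrefl        = λ { refl p → proj₂ (≺-elim p) refl }
    ; trans         = λ {x} {y} {z} p r → ⊏-≼-trans p (proj₁ (≺-elim {y} r))
    ; <-resp-≈      = (λ { refl p → p }) , λ { refl p → p }
    }

  -- Well-founded descent on `y`: an element strictly between replaces `y` until none is left.
  cover-above : ∀ {x y} → x ⊏ y → Σ (Fin k) λ z → T (x ⋖ z) × T (z ≼ y)
  cover-above {x} {y} p = go y (spo-wellFounded ⊏-isStrictPartialOrder y) p
    where
    go : ∀ y → Acc _⊏_ y → x ⊏ y → Σ (Fin k) λ z → T (x ⋖ z) × T (z ≼ y)
    go y (acc rs) p with any? (λ z → T? (x ≺ z) ×-dec T? (z ≺ y))
    ... | yes (z , a , b) = let w , l , r = go z (rs b) a in w , l , transitive w z y r (proj₁ (≺-elim b))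
    ... | no  none        = y , ⋖-intro p (λ z a b → none (z , a , b)) , reflexive y

  cover-below : ∀ {x y} → x ⊏ y → Σ (Fin k) λ z → T (x ≼ z) × T (z ⋖ y)
  cover-below {x} {y} p = go x (spo-noetherian ⊏-isStrictPartialOrder x) p
    where
    go : ∀ x → Acc (flip _⊏_) x → x ⊏ y → Σ (Fin k) λ z → T (x ≼ z) × T (z ⋖ y)
    go x (acc rs) p with any? (λ z → T? (x ≺ z) ×-dec T? (z ≺ y))
    ... | yes (z , a , b) = let w , l , r = go z (rs a) b in w , transitive x z w (proj₁ (≺-elim a)) l , r
    ... | no  none        = x , reflexive x , ⋖-intro p (λ z a b → none (z , a , b))

  step : ∀ {x y} → x ⊏ y → Σ (Fin k) λ z → ρ z ≡ suc (ρ x) × T (x ≼ z) × T (z ≼ y)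
  step {x} p = let z , c , r = cover-above p in
    z , ρ-cover x z c , proj₁ (≺-elim {x} (proj₁ (⋖-elim c))) , r

  -- The axioms control `ρ` only on covers, so the inequality is assembled by removing one cover at
  -- a time from the upper end.
  ρ-mono : ∀ {x y} → x ⊏ y → ρ x < ρ y
  ρ-mono {x} {y} p = go y (spo-wellFounded ⊏-isStrictPartialOrder y) p
    where
    go : ∀ y → Acc _⊏_ y → x ⊏ y → ρ x < ρ y
    go y (acc rs) p with cover-below p
    ... | z , x≼z , z⋖y with x ≟ z
    ... | yes refl = ℕ.≤-reflexive (sym (ρ-cover x y z⋖y))
    ... | no  x≢z  = ℕ.<-trans (go z (rs (proj₁ (⋖-elim z⋖y))) (≺-intro x≼z x≢z))
                               (ℕ.≤-reflexive (sym (ρ-cover z y z⋖y)))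

  same-rank : ∀ {x y} → T (x ≼ y) → ρ x ≡ ρ y → x ≡ y
  same-rank {x} {y} p r with x ≟ y
  ... | yes e = e
  ... | no  d = ⊥-elim (ℕ.<-irrefl r (ρ-mono (≺-intro p d)))

  ρ≤n : ∀ x → ρ x ≤ n
  ρ≤n x with x ≟ top
  ... | yes refl = ℕ.≤-reflexive ρ-top
  ... | no  d    = ℕ.<⇒≤ (subst (ρ x <_) ρ-top (ρ-mono (≺-intro (top-greatest x) d)))

  next : ∀ {x} → ρ x < n → Σ (Fin k) λ z → ρ z ≡ suc (ρ x) × T (x ≼ z)
  next {x} l =
    let z , e , a , _ = step (≺-intro (top-greatest x) λ { refl → ℕ.<-irrefl ρ-top l }) in z , e , a

  prev : ∀ {y i} → ρ y ≡ suc i → Σ (Fin k) λ x → ρ x ≡ i × T (x ≼ y)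
  prev {y} e =
    let x , _ , c = cover-below (≺-intro (bot-least y) λ { refl → ℕ.0≢1+n (trans (sym ρ-bot) e) })
    in x , ℕ.suc-injective (trans (sym (ρ-cover x y c)) e) , proj₁ (≺-elim (proj₁ (⋖-elim c)))

-- An interior rank of a multiplicity-free poset has at most two elements

none : ∀ {m} → Vec Bool m
none {zero}  = []
none {suc m} = false ∷ none

single : ∀ {m} → Fin m → Vec Bool m
single zero    = true ∷ none
single (suc i) = false ∷ single i

∈-none : ∀ {m} (i : Fin m) → ¬ i ∈ none
∈-none zero    ()
∈-none (suc i) h = ∈-none i h

∈-single : ∀ {m} (i : Fin m) → i ∈ single i
∈-single zero    = tt
∈-single (suc i) = ∈-single i

single-∈ : ∀ {m} (i j : Fin m) → j ∈ single i → j ≡ i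
single-∈ zero    zero    h = refl
single-∈ zero    (suc j) h = ⊥-elim (∈-none j h)
single-∈ (suc i) (suc j) h = cong suc (single-∈ i j h)

single-injective : ∀ {m} {i j : Fin m} → single i ≡ single j → i ≡ j
single-injective {i = i} {j} e = single-∈ j i (subst (i ∈_) e (∈-single i))

alt-none : ∀ {m} (F : Vec Bool m → ℤ) → alt none F ≡ F none
alt-none {zero}  F = refl
alt-none {suc m} F = alt-none (F ∘ (false ∷_))

alt-single : ∀ {m} (i : Fin m) F → alt (single i) F ≡ F (single i) - F none
alt-single zero    F = cong₂ _-_ (alt-none (F ∘ (true ∷_))) (alt-none (F ∘ (false ∷_)))
alt-single (suc i) F = alt-single i (F ∘ (false ∷_))

∈-allSubsets : ∀ {m} (C : Vec Bool m) → C List.∈ allSubsets m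
∈-allSubsets []          = here refl
∈-allSubsets (true ∷ C)  = ∈-++⁺ˡ (∈-map⁺ (true ∷_) (∈-allSubsets C))
∈-allSubsets {suc m} (false ∷ C) = ∈-++⁺ʳ (map (true ∷_) (allSubsets m)) (∈-map⁺ (false ∷_) (∈-allSubsets C))

three-members : ∀ {A : Set} {x y z : A} xs → x List.∈ xs → y List.∈ xs → z List.∈ xs →
                x ≢ y → x ≢ z → y ≢ z → 3 ≤ length xs
three-members (_ ∷ [])    (here refl) (here refl) c d e f = ⊥-elim (d refl)
three-members (_ ∷ _ ∷ []) (here refl) (here refl) c d e f = ⊥-elim (d refl)
three-members (_ ∷ _ ∷ []) (here refl) (there (here refl)) (here refl) d e f = ⊥-elim (e refl)
three-members (_ ∷ _ ∷ []) (here refl) (there (here refl)) (there (here refl)) d e f = ⊥-elim (f refl)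
three-members (_ ∷ _ ∷ []) (there (here refl)) (there (here refl)) c d e f = ⊥-elim (d refl)
three-members (_ ∷ _ ∷ []) (there (here refl)) (here refl) (here refl) d e f = ⊥-elim (f refl)
three-members (_ ∷ _ ∷ []) (there (here refl)) (here refl) (there (here refl)) d e f = ⊥-elim (e refl)
three-members (_ ∷ _ ∷ _ ∷ xs) a b c d e f = s≤s (s≤s (s≤s z≤n))

-- In the application `b` counts the chains with empty rank set. Smallness of β(∅) already gives b ≤
-- 1, which replaces a computation of α(∅) and forces a - b ≥ 2.
small-diff : ∀ a b → Small (+ b) → Small (+ a - + b) → ¬ 3 ≤ a
small-diff _ _ (inj₁ refl) (inj₁ ()) (s≤s (s≤s (s≤s _)))
small-diff _ _ (inj₁ refl) (inj₂ (inj₁ ())) (s≤s (s≤s (s≤s _)))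
small-diff _ _ (inj₁ refl) (inj₂ (inj₂ ())) (s≤s (s≤s (s≤s _)))
small-diff _ _ (inj₂ (inj₁ refl)) (inj₁ ()) (s≤s (s≤s (s≤s _)))
small-diff _ _ (inj₂ (inj₁ refl)) (inj₂ (inj₁ ())) (s≤s (s≤s (s≤s _)))
small-diff _ _ (inj₂ (inj₁ refl)) (inj₂ (inj₂ ())) (s≤s (s≤s (s≤s _)))

module _ {n k} (P : GradedPoset n k) (mf : MultiplicityFree P) where
  open GradedPoset P

  -- Distinct elements of one rank are distinct one-element chains, so α of that rank would be at
  -- least 3, while β of it is α minus α(∅).
  no-three : ∀ {i x y z} → i < n ∸ 1 → ρ x ≡ suc i → ρ y ≡ suc i → ρ z ≡ suc i →
             x ≢ y → x ≢ z → y ≢ z → ⊥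
  no-three {i} {x} {y} {z} i<n rx ry rz xy xz yz =
    small-diff (α P S) (α P none)
      (subst Small (trans (β≡alt P none) (alt-none F)) (mf none))
      (subst Small (trans (β≡alt P S) (alt-single j F)) (mf S))
      (three-members _ (member x rx) (member y ry) (member z rz)
        (xy ∘ single-injective) (xz ∘ single-injective) (yz ∘ single-injective))
    where
    j = fromℕ< i<n
    S : RankSet n
    S = single j
    F : RankSet n → ℤ
    F U = + α P U
    pred : Vec Bool k → Bool
    pred C = isChainᵇ P C ∧ rankSetIsᵇ P S C
    ok : ∀ x → ρ x ≡ suc i → T (pred (single x))
    ok x rx = ∧-intro {isChainᵇ P (single x)}
      (allᶠ-intro λ y → allᶠ-intro λ z → ⇒-intro {lookup (single x) y ∧ lookup (single x) z} λ m →
        let a , b = ∧-elim {lookup (single x) y} m in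
        comparable (single-∈ x y a) (single-∈ x z b))
      (∧-intro {allᶠ (λ y → lookup (single x) y ⇒ᵇ anyᶠ (λ i → lookup S i ∧ (ρ y ≡ᵇ suc (toℕ i))))}
        (allᶠ-intro λ y → ⇒-intro {lookup (single x) y} λ m →
          anyᶠ-intro (λ i → lookup S i ∧ (ρ y ≡ᵇ suc (toℕ i))) j
            (∧-intro {lookup S j} (∈-single j) (ρ≡j (single-∈ x y m))))
        (allᶠ-intro λ l → ⇒-intro {lookup S l} λ m →
          anyᶠ-intro (λ y → lookup (single x) y ∧ (ρ y ≡ᵇ suc (toℕ l))) x
            (∧-intro {lookup (single x) x} (∈-single x)
              (subst (λ l → T (ρ x ≡ᵇ suc (toℕ l))) (sym (single-∈ j l m)) (ρ≡j refl)))))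
      where
      comparable : ∀ {y z} → y ≡ x → z ≡ x → T ((y ≼ z) ∨ (z ≼ y))
      comparable refl refl with x ≼ x | reflexive x
      ... | true | _ = tt
      ρ≡j : ∀ {y} → y ≡ x → T (ρ y ≡ᵇ suc (toℕ j))
      ρ≡j refl = ℕ.≡⇒≡ᵇ _ _ (trans rx (cong suc (sym (toℕ-fromℕ< i<n))))
    member : ∀ x → ρ x ≡ suc i → single x List.∈ filterᵇ pred (allSubsets k)
    member x rx = ∈-filter⁺ (T? ∘ pred) (∈-allSubsets (single x)) (ok x rx)

-- Classification

-- The relabellings of a level that its state leaves undetermined.
Ok : State → Bool → Set
Ok oriented σ = σ ≡ false
Ok pair     σ = ⊤
Ok point    σ = ⊤

Ok-false : ∀ q → Ok q false
Ok-false point    = tt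
Ok-false pair     = tt
Ok-false oriented = refl

-- The states are designed for this: `full` and `par` end in a pair whose labels stay free, a path
-- pins the labels of its upper rank by their different degrees, and `parᵒ` carries pinned labels
-- upward. Every other combination is refuted at one entry of the two graphs.
edge-unique : ∀ {q q₁ q₂} (e : Edge q q₁) (e′ : Edge q q₂) σ τ → Ok q σ →
              (∀ s t → graph e′ s t ≡ graph e (σ xor s) (τ xor t)) →
              _≡_ {A = Σ State (Edge q)} (q₁ , e) (q₂ , e′) × Ok q₁ τ
edge-unique full full σ τ ok h = refl , tt
edge-unique full par  σ τ ok h with () ← h false true
edge-unique full zig  σ τ ok h with () ← h true false
edge-unique full parᵒ σ τ ok h with () ← h false true
edge-unique full zigˡ σ τ ok h with () ← h true false
edge-unique full zigʳ σ τ ok h with () ← h false false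
edge-unique par  par  σ τ ok h = refl , tt
edge-unique par  full false false ok h with () ← h false true
edge-unique par  full false true  ok h with () ← h false false
edge-unique par  full true  false ok h with () ← h false false
edge-unique par  full true  true  ok h with () ← h false true
edge-unique par  zig  false false ok h with () ← h false true
edge-unique par  zig  false true  ok h with () ← h false false
edge-unique par  zig  true  false ok h with () ← h false false
edge-unique par  zig  true  true  ok h with () ← h false true
edge-unique zig  full false false ok h with () ← h true false
edge-unique zig  full false true  ok h with () ← h true true
edge-unique zig  full true  false ok h with () ← h false false
edge-unique zig  full true  true  ok h with () ← h false true
edge-unique zig  par  false τ     ok h with () ← h false true
edge-unique zig  par  true  τ     ok h with () ← h true false
edge-unique zig  zig  false false ok h = refl , refl
edge-unique zig  zig  false true  ok h with () ← h true false
edge-unique zig  zig  true  τ     ok h with () ← h true false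
edge-unique parᵒ full false false refl h with () ← h false true
edge-unique parᵒ full false true  refl h with () ← h false false
edge-unique parᵒ parᵒ false false refl h = refl , refl
edge-unique parᵒ parᵒ false true  refl h with () ← h false false
edge-unique parᵒ zigˡ false false refl h with () ← h false true
edge-unique parᵒ zigˡ false true  refl h with () ← h false false
edge-unique parᵒ zigʳ false false refl h with () ← h true false
edge-unique parᵒ zigʳ false true  refl h with () ← h true true
edge-unique zigˡ full false false refl h with () ← h true false
edge-unique zigˡ full false true  refl h with () ← h true true
edge-unique zigˡ parᵒ false τ     refl h with () ← h false true
edge-unique zigˡ zigˡ false false refl h = refl , refl
edge-unique zigˡ zigˡ false true  refl h with () ← h true false
edge-unique zigˡ zigʳ false τ     refl h with () ← h false false
edge-unique zigʳ full false false refl h with () ← h false false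
edge-unique zigʳ full false true  refl h with () ← h false true
edge-unique zigʳ parᵒ false τ     refl h with () ← h true false
edge-unique zigʳ zigˡ false τ     refl h with () ← h true false
edge-unique zigʳ zigʳ false false refl h = refl , refl
edge-unique zigʳ zigʳ false true  refl h with () ← h false false

table : Bool → Bool → Bool → Bool → Bool → Bool → Bool
table a b c d false false = a
table a b c d false true  = b
table a b c d true  false = c
table a b c d true  true  = d

-- ν relabels the upper level in advance; whatever further relabelling τ the levels
-- above it require is absorbed by σ.
Choice : State → (Bool → Bool → Bool) → Set
Choice q g = Σ State λ q′ → Σ (Edge q q′) λ e → Σ Bool λ ν → ∀ τ → Ok q′ τ →
  Σ Bool λ σ → Ok q σ × (∀ s t → graph e s t ≡ g (σ xor s) (ν xor (τ xor t)))

-- With no zero row or column there remain seven 2×2 relations: the full one, two matchings and four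
-- paths. At `oriented` only the upper labels can be adapted, so a path is `zigˡ` or `zigʳ`
-- according to which lower element has two covers; at `pair` the lower swap identifies these two as
-- `zig`. At `point` the rows are equal and only `full` is left.
edge-exists : ∀ q a b c d → T (a ∨ b) → T (c ∨ d) → T (a ∨ c) → T (b ∨ d) →
              (q ≡ point → a ≡ c × b ≡ d) → Choice q (table a b c d)
edge-exists q false false c d () _ _ _ pt
edge-exists q a b false false _ () _ _ pt
edge-exists q false b false d _ _ () _ pt
edge-exists q a false c false _ _ _ () pt
edge-exists q true true true true _ _ _ _ pt = pair , full , false , λ τ _ → false , Ok-false q ,
  λ { false t → col (τ xor t) ; true t → sym (row (τ xor t)) }
  where
  col : ∀ t → true ≡ table true true true true false t
  col false = refl
  col true  = refl
  row : ∀ t → table true true true true true t ≡ true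
  row false = refl
  row true  = refl
edge-exists point true false false true _ _ _ _ pt with () ← proj₁ (pt refl)
edge-exists point false true true false _ _ _ _ pt with () ← proj₁ (pt refl)
edge-exists point true true false true  _ _ _ _ pt with () ← proj₁ (pt refl)
edge-exists point true true true false  _ _ _ _ pt with () ← proj₂ (pt refl)
edge-exists point false true true true  _ _ _ _ pt with () ← proj₁ (pt refl)
edge-exists point true false true true  _ _ _ _ pt with () ← proj₂ (pt refl)
edge-exists pair true false false true _ _ _ _ pt = pair , par , false , λ
  { false _ → false , tt , λ { false false → refl ; false true → refl ; true false → refl ; true true → refl }
  ; true  _ → true  , tt , λ { false false → refl ; false true → refl ; true false → refl ; true true → refl } }
edge-exists pair false true true false _ _ _ _ pt = pair , par , true , λ
  { false _ → false , tt , λ { false false → refl ; false true → refl ; true false → refl ; true true → refl }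
  ; true  _ → true  , tt , λ { false false → refl ; false true → refl ; true false → refl ; true true → refl } }
edge-exists pair true true false true _ _ _ _ pt = oriented , zig , false , λ { _ refl → false , tt ,
  λ { false false → refl ; false true → refl ; true false → refl ; true true → refl } }
edge-exists pair true true true false _ _ _ _ pt = oriented , zig , true , λ { _ refl → false , tt ,
  λ { false false → refl ; false true → refl ; true false → refl ; true true → refl } }
edge-exists pair false true true true _ _ _ _ pt = oriented , zig , false , λ { _ refl → true , tt ,
  λ { false false → refl ; false true → refl ; true false → refl ; true true → refl } }
edge-exists pair true false true true _ _ _ _ pt = oriented , zig , true , λ { _ refl → true , tt ,
  λ { false false → refl ; false true → refl ; true false → refl ; true true → refl } }
edge-exists oriented true false false true _ _ _ _ pt = oriented , parᵒ , false , λ { _ refl → false , refl ,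
  λ { false false → refl ; false true → refl ; true false → refl ; true true → refl } }
edge-exists oriented false true true false _ _ _ _ pt = oriented , parᵒ , true , λ { _ refl → false , refl ,
  λ { false false → refl ; false true → refl ; true false → refl ; true true → refl } }
edge-exists oriented true true false true _ _ _ _ pt = oriented , zigˡ , false , λ { _ refl → false , refl ,
  λ { false false → refl ; false true → refl ; true false → refl ; true true → refl } }
edge-exists oriented true true true false _ _ _ _ pt = oriented , zigˡ , true , λ { _ refl → false , refl ,
  λ { false false → refl ; false true → refl ; true false → refl ; true true → refl } }
edge-exists oriented false true true true _ _ _ _ pt = oriented , zigʳ , false , λ { _ refl → false , refl ,
  λ { false false → refl ; false true → refl ; true false → refl ; true true → refl } }
edge-exists oriented true false true true _ _ _ _ pt = oriented , zigʳ , true , λ { _ refl → false , refl ,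
  λ { false false → refl ; false true → refl ; true false → refl ; true true → refl } }

∨-introˡ : ∀ {a b} → T a → T (a ∨ b)
∨-introˡ {true} _ = tt

∨-introʳ : ∀ {a b} → T b → T (a ∨ b)
∨-introʳ {false} h = h
∨-introʳ {true}  h = tt

true≡ : ∀ {b} → T b → true ≡ b
true≡ {true} _ = refl

labels : ∀ {A : Set} → A → A → Bool → A
labels x y false = x
labels x y true  = y

-- Reading a code off a poset

module Fitting {N K} (P : GradedPoset N K) where
  open GradedPoset P
  open Strict poset
  open Graded P

  ρ-≤ : ∀ {x y} → T (x ≼ y) → ρ x ≤ ρ y
  ρ-≤ {x} {y} p with x ≟ y
  ... | yes refl = ℕ.≤-refl
  ... | no  d    = ℕ.<⇒≤ (ρ-mono (≺-intro p d))

  -- The code c describes the part of P above rank i, where u labels the elements of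
  -- rank i.
  record Fit {q m k} (i : ℕ) (u : Bool → Fin K) (c : Code q m k) : Set where
    field
      f     : Fin k → Fin K
      f-le  : ∀ x y → le c x y ≡ (f x ≼ f y)
      f-rel : ∀ s y → rel c s y ≡ (u s ≼ f y)
      f-rk  : ∀ x → ρ (f x) ≡ suc (i ℕ.+ rk c x)
      f-sur : ∀ z → i < ρ z → Σ (Fin k) λ x → f x ≡ z

    f-injective : ∀ {x y} → f x ≡ f y → x ≡ y
    f-injective {x} {y} e = le-antisym c x y
      (subst T (sym (f-le x y)) (subst (λ z → T (f x ≼ z)) e (reflexive (f x))))
      (subst T (sym (f-le y x)) (subst (λ z → T (z ≼ f x)) e (reflexive (f x))))
  open Fit

  Fit-cong : ∀ {q m k i u v} {c : Code q m k} → (∀ s → u s ≡ v s) → Fit i u c → Fit i v c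
  Fit-cong h F = record
    { f = f F ; f-le = f-le F ; f-rk = f-rk F ; f-sur = f-sur F
    ; f-rel = λ s y → trans (f-rel F s y) (cong (_≼ f F y) (h s)) }

  -- The labels may coincide: a rank with one element is labelled by a constant function.
  record Level (i : ℕ) (u : Bool → Fin K) : Set where
    constructor level
    field
      rank  : ∀ s → ρ (u s) ≡ i
      cover : ∀ z → ρ z ≡ i → Σ Bool λ s → z ≡ u s
  open Level

  Lab : State → (Bool → Fin K) → Set
  Lab point u = u false ≡ u true
  Lab _     u = u false ≢ u true

  ¬below : ∀ {q m k i u v} {c : Code q m k} (F : Fit i u c) → ρ v ≡ i → ∀ x → false ≡ (f F x ≼ v)
  ¬below {v = v} F r x = T-ext (λ ()) λ p →
    ℕ.<⇒≱ (s≤s (ℕ.m≤m+n _ _)) (subst₂ _≤_ (f-rk F x) r (ρ-≤ p))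

  -- An inequality reaching beyond the next rank passes through it. Hence the relations between
  -- consecutive ranks determine the whole order, as the codes presuppose.
  through : ∀ {i u v z} → Level i u → Level (suc i) v → suc i < ρ z →
            ∀ s → T (u s ≼ z) → Σ Bool λ t → T (u s ≼ v t) × T (v t ≼ z)
  through {i} {u} {v} {z} U V l s p with step (≺-intro p u≢z)
    where
    u≢z : u s ≢ z
    u≢z refl = ℕ.<-irrefl refl (ℕ.<-trans (ℕ.n<1+n _) (subst (suc i <_) (rank U s) l))
  ... | w , rw , a , b with cover V w (trans rw (cong suc (rank U s)))
  ... | t , refl = t , a , b

  above-suc : ∀ {q m k i u} {c : Code q m k} (F : Fit (suc i) u c) x → suc i < ρ (f F x)
  above-suc F x = subst (_ <_) (sym (f-rk F x)) (s≤s (ℕ.m≤m+n _ _))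

  rk-shift : ∀ {i r x} → ρ x ≡ suc (suc i ℕ.+ r) → ρ x ≡ suc (i ℕ.+ suc r)
  rk-shift {i} {r} e = trans e (cong suc (sym (ℕ.+-suc i r)))

  rk-first : ∀ {i x} → ρ x ≡ suc i → ρ x ≡ suc (i ℕ.+ 0)
  rk-first {i} e = trans e (cong suc (sym (ℕ.+-identityʳ i)))

  fit-one : ∀ {q m k i u v} {c : Code point m k} → Level i u → Level (suc i) (λ _ → v) →
            (∀ s → T (u s ≼ v)) → Fit (suc i) (λ _ → v) c → Fit i u (one {q = q} c)
  fit-one {q} {k = k} {i} {u} {v} {c} U V u≼v F =
    record { f = g ; f-le = g-le ; f-rel = g-rel ; f-rk = g-rk ; f-sur = g-sur }
    where
    d = one {q = q} c
    g : Fin (suc k) → Fin K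
    g zero    = v
    g (suc x) = f F x
    g-le : ∀ x y → le d x y ≡ (g x ≼ g y)
    g-le zero    zero    = true≡ (reflexive v)
    g-le zero    (suc y) = f-rel F false y
    g-le (suc x) zero    = ¬below F (rank V false) x
    g-le (suc x) (suc y) = f-le F x y
    g-rel : ∀ s y → rel d s y ≡ (u s ≼ g y)
    g-rel s zero    = true≡ (u≼v s)
    g-rel s (suc y) = T-ext
      (λ p → transitive _ _ _ (u≼v s) (subst T (f-rel F false y) p))
      (λ p → subst T (sym (f-rel F false y)) (proj₂ (proj₂ (through U V (above-suc F y) s p))))
    g-rk : ∀ x → ρ (g x) ≡ suc (i ℕ.+ rk d x)
    g-rk zero    = rk-first (rank V false)
    g-rk (suc x) = rk-shift (f-rk F x)
    g-sur : ∀ z → i < ρ z → Σ (Fin (suc k)) λ x → g x ≡ z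
    g-sur z l with suc i ℕ.≟ ρ z
    ... | yes e = zero , sym (proj₂ (cover V z (sym e)))
    ... | no  d = let x , e = f-sur F z (ℕ.≤∧≢⇒< l d) in suc x , e

  fit-two : ∀ {q q′ m k i u v} (e : Edge q q′) {c : Code q′ m k} → Level i u → Level (suc i) v →
            v false ≢ v true → (∀ s t → graph e s t ≡ (u s ≼ v t)) →
            Fit (suc i) v c → Fit i u (two e c)
  fit-two {k = k} {i} {u} {v} e {c} U V v≢ h F =
    record { f = g ; f-le = g-le ; f-rel = g-rel ; f-rk = g-rk ; f-sur = g-sur }
    where
    d = two e c
    g : Fin (suc (suc k)) → Fin K
    g zero          = v false
    g (suc zero)    = v true
    g (suc (suc x)) = f F x
    incomparable : ∀ {s t} → v s ≢ v t → false ≡ (v s ≼ v t)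
    incomparable d = T-ext (λ ()) λ p → d (same-rank p (trans (rank V _) (sym (rank V _))))
    g-le : ∀ x y → le d x y ≡ (g x ≼ g y)
    g-le zero          zero          = true≡ (reflexive _)
    g-le zero          (suc zero)    = incomparable v≢
    g-le zero          (suc (suc y)) = f-rel F false y
    g-le (suc zero)    zero          = incomparable (v≢ ∘ sym)
    g-le (suc zero)    (suc zero)    = true≡ (reflexive _)
    g-le (suc zero)    (suc (suc y)) = f-rel F true y
    g-le (suc (suc x)) zero          = ¬below F (rank V false) x
    g-le (suc (suc x)) (suc zero)    = ¬below F (rank V true) x
    g-le (suc (suc x)) (suc (suc y)) = f-le F x y
    g-rel : ∀ s y → rel d s y ≡ (u s ≼ g y)
    g-rel s zero          = h s false
    g-rel s (suc zero)    = h s true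
    g-rel s (suc (suc y)) = T-ext
      (λ p → let t , a , b = rel-two e c s y p
             in transitive _ _ _ (subst T (h s t) a) (subst T (f-rel F t y) b))
      (λ p → let t , a , b = through U V (above-suc F y) s p
             in two-rel e c s t y (subst T (sym (h s t)) a) (subst T (sym (f-rel F t y)) b))
    g-rk : ∀ x → ρ (g x) ≡ suc (i ℕ.+ rk d x)
    g-rk zero          = rk-first (rank V false)
    g-rk (suc zero)    = rk-first (rank V true)
    g-rk (suc (suc x)) = rk-shift (f-rk F x)
    g-sur : ∀ z → i < ρ z → Σ (Fin (suc (suc k))) λ x → g x ≡ z
    g-sur z l with suc i ℕ.≟ ρ z
    ... | no  d = let x , e = f-sur F z (ℕ.≤∧≢⇒< l d) in suc (suc x) , e
    ... | yes e with cover V z (sym e)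
    ... | false , r = zero , sym r
    ... | true  , r = suc zero , sym r

  first-rank : ∀ {q m k i u} {c : Code q m k} (F : Fit i u c) {x} → rk c x ≡ 0 → ρ (f F x) ≡ suc i
  first-rank {i = i} F {x} r = trans (f-rk F x) (cong suc (trans (cong (λ j → i ℕ.+ j) r) (ℕ.+-identityʳ i)))

  tail-one : ∀ {q m k i u} {c : Code point m k} (F : Fit i u (one {q = q} c)) → Fit (suc i) (λ _ → f F zero) c
  tail-one {i = i} {c = c} F = record
    { f     = f F ∘ suc
    ; f-le  = λ x y → f-le F (suc x) (suc y)
    ; f-rel = λ s y → trans (rel-point c s y) (f-le F zero (suc y))
    ; f-rk  = λ x → trans (f-rk F (suc x)) (cong suc (ℕ.+-suc i _))
    ; f-sur = sur
    }
    where
    sur : ∀ z → suc i < ρ z → Σ (Fin _) λ x → f F (suc x) ≡ z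
    sur z l with f-sur F z (ℕ.<-trans (ℕ.n<1+n i) l)
    ... | suc x , e    = x , e
    ... | zero  , refl = ⊥-elim (ℕ.<-irrefl (sym (first-rank F {zero} refl)) l)

  tail-two : ∀ {q q′ m k i u} {e : Edge q q′} {c : Code q′ m k} (F : Fit i u (two e c)) →
             Fit (suc i) (λ t → f F (side t)) c
  tail-two {i = i} {e = e} {c} F = record
    { f     = λ x → f F (suc (suc x))
    ; f-le  = λ x y → f-le F (suc (suc x)) (suc (suc y))
    ; f-rel = λ s y → trans (sym (le-side e c s y)) (f-le F (side s) (suc (suc y)))
    ; f-rk  = λ x → trans (f-rk F (suc (suc x))) (cong suc (ℕ.+-suc i _))
    ; f-sur = sur
    }
    where
    low : ∀ {z} x → rk (two e c) x ≡ 0 → f F x ≡ z → ¬ suc i < ρ z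
    low x r refl l = ℕ.<-irrefl (sym (first-rank F r)) l
    sur : ∀ z → suc i < ρ z → Σ (Fin _) λ x → f F (suc (suc x)) ≡ z
    sur z l with f-sur F z (ℕ.<-trans (ℕ.n<1+n i) l)
    ... | suc (suc x) , e = x , e
    ... | suc zero    , e = ⊥-elim (low (suc zero) refl e l)
    ... | zero        , e = ⊥-elim (low zero refl e l)

  rk-zero : ∀ {q m k i u} {c : Code q m k} (F : Fit i u c) {z x} → ρ z ≡ suc i → f F x ≡ z → rk c x ≡ 0
  rk-zero {i = i} F {x = x} r refl =
    ℕ.+-cancelˡ-≡ i _ _ (trans (ℕ.suc-injective (trans (sym (f-rk F x)) r)) (sym (ℕ.+-identityʳ i)))

  find-one : ∀ {q m k i u} {c : Code point m k} (F : Fit i u (one {q = q} c)) {z} → ρ z ≡ suc i → f F zero ≡ z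
  find-one F {z} r with f-sur F z (ℕ.≤-reflexive (sym r))
  ... | zero  , e = e
  ... | suc x , e with () ← rk-zero F r e

  find-two : ∀ {q q′ m k i u} {e : Edge q q′} {c : Code q′ m k} (F : Fit i u (two e c)) {z} → ρ z ≡ suc i →
             Σ Bool λ t → f F (side t) ≡ z
  find-two F {z} r with f-sur F z (ℕ.≤-reflexive (sym r))
  ... | zero        , e = false , e
  ... | suc zero    , e = true , e
  ... | suc (suc x) , e with () ← rk-zero F r e

  one≢two : ∀ {q m m′ k k′ i u u′ q′} {c : Code point m k} {e : Edge q q′} {c′ : Code q′ m′ k′} →
            Fit i u (one {q = q} c) → Fit i u′ (two e c′) → ⊥
  one≢two F G with () ← f-injective G {zero} {suc zero}
    (trans (sym (find-one F (first-rank G {zero} refl))) (find-one F (first-rank G {suc zero} refl)))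

  -- Both codes enumerate the same two elements of rank `suc i` without repetition, so the orders
  -- are equal or opposite.
  relabelling : ∀ {q q₁ q₂ m m′ k k′ i u u′} {e : Edge q q₁} {c : Code q₁ m k} {e′ : Edge q q₂} {c′ : Code q₂ m′ k′}
                (F : Fit i u (two e c)) (G : Fit i u′ (two e′ c′)) →
                Σ Bool λ τ → ∀ t → f F (side (τ xor t)) ≡ f G (side t)
  relabelling F G with find-two F (first-rank G {zero} refl) | find-two F (first-rank G {suc zero} refl)
  ... | false , p | true  , r = false , λ { false → p ; true → r }
  ... | true  , p | false , r = true , λ { false → p ; true → r }
  ... | false , p | false , r with () ← f-injective G {zero} {suc zero} (trans (sym p) r)
  ... | true  , p | true  , r with () ← f-injective G {zero} {suc zero} (trans (sym p) r)

  -- Two codes may list a free pair in opposite orders, so the induction has to admit a discrepancy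
  -- `σ` permitted by the state. `edge-unique` makes the edges agree and shows that the discrepancy
  -- `τ` one rank higher is permitted again.
  fit-unique : ∀ {q m k i u} (c c′ : Code q m k) σ → Ok q σ →
               Fit i u c → Fit i (λ s → u (σ xor s)) c′ → c ≡ c′
  fit-unique nil nil σ ok F G = refl
  fit-unique (one c) (one c′) σ ok F G = cong one (fit-unique c c′ false tt (tail-one F)
    (Fit-cong (λ _ → sym (find-one F (first-rank G {zero} refl))) (tail-one G)))
  fit-unique (one c) (two e c′) σ ok F G = ⊥-elim (one≢two F G)
  fit-unique (two e c) (one c′) σ ok F G = ⊥-elim (one≢two G F)
  fit-unique {u = u} (two e c) (two e′ c′) σ ok F G with relabelling F G
  ... | τ , h with edge-unique e e′ σ τ ok graphs
    where
    graphs : ∀ s t → graph e′ s t ≡ graph e (σ xor s) (τ xor t)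
    graphs s t = trans (sym (rel-side e′ c′ s t)) (trans (f-rel G s (side t))
      (trans (cong (u (σ xor s) ≼_) (sym (h t)))
        (trans (sym (f-rel F (σ xor s) (side (τ xor t)))) (rel-side e c (σ xor s) (τ xor t)))))
  ... | refl , ok′ = cong (two e) (fit-unique c c′ τ ok′ (tail-two F) (Fit-cong (λ t → sym (h t)) (tail-two G)))

  relabel-level : ∀ {i u} σ → Level i u → Level i (λ s → u (σ xor s))
  relabel-level false U = U
  relabel-level {u = u} true U = level (λ s → rank U (not s)) λ z r → opposite (cover U z r)
    where
    opposite : ∀ {z} → (Σ Bool λ s → z ≡ u s) → Σ Bool λ s → z ≡ u (not s)
    opposite (false , e) = true , e
    opposite (true  , e) = false , e

  relabel-≢ : ∀ {v : Bool → Fin K} σ → v false ≢ v true → v (σ xor false) ≢ v (σ xor true)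
  relabel-≢ false d = d
  relabel-≢ true  d = d ∘ sym

  edge-lab : ∀ {q q′ v} → Edge q q′ → v false ≢ v true → Lab q′ v
  edge-lab full d = d
  edge-lab par  d = d
  edge-lab zig  d = d
  edge-lab parᵒ d = d
  edge-lab zigˡ d = d
  edge-lab zigʳ d = d

  table-η : ∀ (g : Bool → Bool → Bool) s t →
            table (g false false) (g false true) (g true false) (g true true) s t ≡ g s t
  table-η g false false = refl
  table-η g false true  = refl
  table-η g true  false = refl
  table-η g true  true  = refl

  top-unique : ∀ {x} → ρ x ≡ N → x ≡ top
  top-unique {x} r = same-rank (top-greatest x) (trans r (sym ρ-top))

  bot-unique : ∀ {x} → ρ x ≡ 0 → x ≡ bot
  bot-unique {x} r = sym (same-rank (bot-least x) (trans ρ-bot (sym r)))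

  choose : ∀ q {i u v} → i < N → Level i u → Level (suc i) v → Lab q u → Choice q (λ s t → u s ≼ v t)
  choose q {i} {u} {v} i<N U V lab =
    let q′ , e , ν , h = edge-exists q (u false ≼ v false) (u false ≼ v true) (u true ≼ v false) (u true ≼ v true)
          (row false) (row true) (column false) (column true) λ { refl → cong (_≼ v false) lab , cong (_≼ v true) lab }
    in q′ , e , ν , λ τ ok → let σ , ok′ , g = h τ ok
                             in σ , ok′ , λ s t → trans (g s t) (table-η (λ s t → u s ≼ v t) _ _)
    where
    row : ∀ s → T ((u s ≼ v false) ∨ (u s ≼ v true))
    row s with next {u s} (subst (_< N) (sym (rank U s)) i<N)
    ... | z , rz , a with cover V z (trans rz (cong suc (rank U s)))
    ... | false , refl = ∨-introˡ a
    ... | true  , refl = ∨-introʳ {u s ≼ v false} a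
    column : ∀ t → T ((u false ≼ v t) ∨ (u true ≼ v t))
    column t with prev (rank V t)
    ... | x , rx , a with cover U x rx
    ... | false , refl = ∨-introˡ a
    ... | true  , refl = ∨-introʳ {u false ≼ v t} a

  module _ (mf : MultiplicityFree P) where

    -- A third element is excluded by `no-three` at interior ranks; at rank `N` uniqueness of the
    -- top excludes even the second.
    pair-level : ∀ {i v w} → suc i ≤ N → ρ v ≡ suc i → ρ w ≡ suc i → w ≢ v →
                 Level (suc i) (labels v w)
    pair-level {i} {v} {w} l rv rw w≢v = level (λ { false → rv ; true → rw }) find
      where
      find : ∀ z → ρ z ≡ suc i → Σ Bool λ s → z ≡ labels v w s
      find z rz with z ≟ v | z ≟ w
      ... | yes e | _     = false , e
      ... | no  _ | yes e = true , e
      ... | no z≢v | no z≢w with suc i ℕ.≟ N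
      ... | yes refl = ⊥-elim (w≢v (trans (top-unique rw) (sym (top-unique rv))))
      ... | no  d    = ⊥-elim (no-three P mf (ℕ.∸-monoˡ-≤ 1 (ℕ.≤∧≢⇒< l d)) rz rv rw z≢v z≢w (w≢v ∘ sym))

    -- Induction on the number `m` of ranks above. The order of a free pair may be prescribed by a
    -- path higher up, and `par` hands such a demand down; this is why `σ` is a result and not a
    -- datum.
    fit-exists : ∀ m i → m ℕ.+ i ≡ N → ∀ q u → Level i u → Lab q u →
                 Σ Bool λ σ → Ok q σ × Σ ℕ λ k → Σ (Code q m k) λ c → Fit i (λ s → u (σ xor s)) c
    fit-exists zero i refl point u U lab = false , tt , 0 , nil ,
      record { f = λ () ; f-le = λ () ; f-rel = λ s () ; f-rk = λ () ; f-sur = λ z l → ⊥-elim (ℕ.<⇒≱ l (ρ≤n z)) }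
    fit-exists zero i refl pair u U lab = ⊥-elim (lab (trans (top-unique (rank U false)) (sym (top-unique (rank U true)))))
    fit-exists zero i refl oriented u U lab = ⊥-elim (lab (trans (top-unique (rank U false)) (sym (top-unique (rank U true)))))
    fit-exists (suc m) i eq q u U lab with next {u false} (subst (_< N) (sym (rank U false)) i<N)
      where
      i<N : i < N
      i<N = subst (i <_) eq (s≤s (ℕ.m≤n+m i m))
    ... | v , rv , _ with any? (λ w → ρ w ℕ.≟ suc i ×-dec ¬? (w ≟ v))
    ... | no unique = false , Ok-false q , suc k , one c , fit-one U V u≼v F
      where
      i<N : i < N
      i<N = subst (i <_) eq (s≤s (ℕ.m≤n+m i m))
      rv′ : ρ v ≡ suc i
      rv′ = trans rv (cong suc (rank U false))
      only-v : ∀ z → ρ z ≡ suc i → z ≡ v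
      only-v z rz with z ≟ v
      ... | yes e = e
      ... | no  d = ⊥-elim (unique (z , rz , d))
      V : Level (suc i) (λ _ → v)
      V = level (λ _ → rv′) λ z rz → false , only-v z rz
      u≼v : ∀ s → T (u s ≼ v)
      u≼v s with next {u s} (subst (_< N) (sym (rank U s)) i<N)
      ... | z , rz , a = subst (λ z → T (u s ≼ z)) (only-v z (trans rz (cong suc (rank U s)))) a
      rest = fit-exists m (suc i) (trans (ℕ.+-suc m i) eq) point (λ _ → v) V refl
      k = proj₁ (proj₂ (proj₂ rest))
      c = proj₁ (proj₂ (proj₂ (proj₂ rest)))
      F = proj₂ (proj₂ (proj₂ (proj₂ rest)))
    ... | yes (w , rw , w≢v) = result
      where
      i<N : i < N
      i<N = subst (i <_) eq (s≤s (ℕ.m≤n+m i m))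
      x : Bool → Fin K
      x = labels v w
      V : Level (suc i) x
      V = pair-level i<N (trans rv (cong suc (rank U false))) rw w≢v
      result : Σ Bool λ σ → Ok q σ × Σ ℕ λ k → Σ (Code q (suc m) k) λ c → Fit i (λ s → u (σ xor s)) c
      result with choose q i<N U V lab
      -- `ν` comes before the recursion, since an oriented `q′` tolerates no later swap; the `τ`
      -- that the recursion returns is then absorbed into `σ` by `h`.
      ... | q′ , e , ν , h with fit-exists m (suc i) (trans (ℕ.+-suc m i) eq) q′ (λ t → x (ν xor t))
                                  (relabel-level ν V) (edge-lab e (relabel-≢ {x} ν (w≢v ∘ sym)))
      ... | τ , ok , k , c , F with h τ ok
      ... | σ , ok′ , g = σ , ok′ , suc (suc k) , two e c ,
        fit-two e (relabel-level σ U) (relabel-level τ (relabel-level ν V))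
          (relabel-≢ {λ t → x (ν xor t)} τ (relabel-≢ {x} ν (w≢v ∘ sym))) g F

  bot-level : Level 0 (λ _ → bot)
  bot-level = level (λ _ → ρ-bot) λ z r → false , bot-unique r

  fit-isomorphism : ∀ {k} (c : Code point N k) → Fit 0 (λ _ → bot) c →
    Σ (Permutation K (suc k)) λ π → ∀ x y → (x ≼ y) ≡ le (one {q = point} c) (π ⟨$⟩ʳ x) (π ⟨$⟩ʳ y)
  fit-isomorphism {k} c F = permutation h g h∘g g∘h , λ x y →
    trans (cong₂ _≼_ (sym (g∘h x)) (sym (g∘h y))) (sym (g-le (h x) (h y)))
    where
    d = one {q = point} c
    g : Fin (suc k) → Fin K
    g zero    = bot
    g (suc x) = f F x
    g-le : ∀ x y → le d x y ≡ (g x ≼ g y)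
    g-le zero    zero    = true≡ (reflexive bot)
    g-le zero    (suc y) = f-rel F false y
    g-le (suc x) zero    = ¬below F ρ-bot x
    g-le (suc x) (suc y) = f-le F x y
    g-sur : ∀ z → Σ (Fin (suc k)) λ x → g x ≡ z
    g-sur z with z ≟ bot
    ... | yes e = zero , sym e
    ... | no  d = let x , e = f-sur F z (subst (_< ρ z) ρ-bot (ρ-mono (≺-intro (bot-least z) (d ∘ sym)))) in suc x , e
    h : Fin K → Fin (suc k)
    h z = proj₁ (g-sur z)
    g∘h : ∀ z → g (h z) ≡ z
    g∘h z = proj₂ (g-sur z)
    h∘g : ∀ x → h (g x) ≡ x
    h∘g x = le-antisym d _ _
      (subst T (sym (g-le (h (g x)) x)) (subst (λ z → T (z ≼ g x)) (sym (g∘h (g x))) (reflexive (g x))))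
      (subst T (sym (g-le x (h (g x)))) (subst (λ z → T (g x ≼ z)) (sym (g∘h (g x))) (reflexive (g x))))

-- Isomorphisms preserve rank; codes represent isomorphism classes

module _ {n k} (P Q : GradedPoset n k) (iso : Isomorphic P Q) where
  private
    module P = GradedPoset P
    module Q = GradedPoset Q
    module SP = Strict P.poset
    module SQ = Strict Q.poset
    π = proj₁ iso
    π-≼ = proj₂ iso

  π-injective : ∀ {x y} → π ⟨$⟩ʳ x ≡ π ⟨$⟩ʳ y → x ≡ y
  π-injective e = trans (sym (inverseˡ π)) (trans (cong (π ⟨$⟩ˡ_) e) (inverseˡ π))

  π-≺ : ∀ {x y} → T (x P.≺ y) → T ((π ⟨$⟩ʳ x) Q.≺ (π ⟨$⟩ʳ y))
  π-≺ {x} {y} p = let a , d = SP.≺-elim p in SQ.≺-intro (subst T (π-≼ x y) a) (d ∘ π-injective)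

  ≺-π : ∀ {x y} → T ((π ⟨$⟩ʳ x) Q.≺ (π ⟨$⟩ʳ y)) → T (x P.≺ y)
  ≺-π {x} {y} p = let a , d = SQ.≺-elim p in SP.≺-intro (subst T (sym (π-≼ x y)) a) (d ∘ cong (π ⟨$⟩ʳ_))

  π-⋖ : ∀ {x y} → T (x P.⋖ y) → T ((π ⟨$⟩ʳ x) Q.⋖ (π ⟨$⟩ʳ y))
  π-⋖ {x} {y} c = let a , gap = SP.⋖-elim c in SQ.⋖-intro (π-≺ a) λ z p r →
    gap (π ⟨$⟩ˡ z)
      (≺-π (subst (λ w → T ((π ⟨$⟩ʳ x) Q.≺ w)) (sym (inverseʳ π)) p))
      (≺-π (subst (λ w → T (w Q.≺ (π ⟨$⟩ʳ y))) (sym (inverseʳ π)) r))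

  π-bot : π ⟨$⟩ʳ P.bot ≡ Q.bot
  π-bot = Q.antisym _ _
    (subst (λ z → T ((π ⟨$⟩ʳ P.bot) Q.≼ z)) (inverseʳ π) (subst T (π-≼ P.bot (π ⟨$⟩ˡ Q.bot)) (P.bot-least _)))
    (Q.bot-least _)

  -- An isomorphism preserves the order, hence covers; descending along covers to the bottom, where
  -- both ranks are 0, recovers the rank.
  isomorphism-ρ : ∀ x → Q.ρ (π ⟨$⟩ʳ x) ≡ P.ρ x
  isomorphism-ρ x = go x (spo-wellFounded (Graded.⊏-isStrictPartialOrder P) x)
    where
    go : ∀ x → Acc (Graded._⊏_ P) x → Q.ρ (π ⟨$⟩ʳ x) ≡ P.ρ x
    go x (acc rs) with x ≟ P.bot
    ... | yes refl = trans (cong Q.ρ π-bot) (trans Q.ρ-bot (sym P.ρ-bot))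
    ... | no  d    =
      let w , _ , c = Graded.cover-below P (SP.≺-intro (P.bot-least x) (d ∘ sym))
      in trans (Q.ρ-cover _ _ (π-⋖ c)) (trans (cong suc (go w (rs (proj₁ (SP.⋖-elim c))))) (sym (P.ρ-cover w x c)))

isomorphism-fit : ∀ {n k} (P : GradedPoset n (suc k)) (c : Code point n k) → Isomorphic P (codeGraded c) →
                  Fitting.Fit P 0 (λ _ → GradedPoset.bot P) c
isomorphism-fit P c iso@(π , π-≼) = record
  { f     = g
  ; f-le  = λ x y → sym (trans (π-≼ (g x) (g y)) (cong₂ (le d) (inverseʳ π) (inverseʳ π)))
  ; f-rel = λ s y → trans (sym (true≡ (subst T (sym (rel-point c s y)) (subst T (rel-point c _ y) (proj₂ (rel-onto c y))))))
                          (true≡ (GradedPoset.bot-least P (g y)))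
  ; f-rk  = λ x → trans (sym (isomorphism-ρ P (codeGraded c) iso (g x))) (cong (rk d) (inverseʳ π))
  ; f-sur = sur
  }
  where
  d = one {q = point} c
  g = λ x → π ⟨$⟩ˡ suc x
  sur : ∀ z → 0 < GradedPoset.ρ P z → Σ (Fin _) λ x → π ⟨$⟩ˡ suc x ≡ z
  sur z l with π ⟨$⟩ʳ z in e
  ... | suc x = x , trans (cong (π ⟨$⟩ˡ_) (sym e)) (inverseˡ π)
  ... | zero  = ⊥-elim (ℕ.<-irrefl (trans (cong (rk d) (sym e)) (isomorphism-ρ P (codeGraded c) iso z)) l)

-- Both codes are fitted to one poset, that of `c`: the first by the identity, the second through
-- the given isomorphism.
code-unique : ∀ {n k} (c c′ : Code point n k) → Isomorphic (codeGraded c) (codeGraded c′) → c ≡ c′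
code-unique c c′ iso = Fitting.fit-unique (codeGraded c) c c′ false tt
  (isomorphism-fit (codeGraded c) c (Perm.id , λ x y → refl)) (isomorphism-fit (codeGraded c) c′ iso)

code-exists : ∀ {n k} (P : GradedPoset n (suc k)) → MultiplicityFree P →
              Σ (Code point n k) λ c → Isomorphic P (codeGraded c)
code-exists {n} {k₀} P mf =
  let _ , _ , k , c , F = Fitting.fit-exists P mf n 0 (ℕ.+-identityʳ n) point (λ _ → bot) (Fitting.bot-level P) refl
      π , h = Fitting.fit-isomorphism P c F
  -- `fit-exists` leaves the number of elements of the code open; the bijection identifies it.
  in cast c π h (↔⇒≡ π)
  where
  open GradedPoset P
  cast : ∀ {k′} (c : Code point n k′) (π : Permutation (suc k₀) (suc k′)) →
         (∀ x y → (x ≼ y) ≡ le (one {q = point} c) (π ⟨$⟩ʳ x) (π ⟨$⟩ʳ y)) → suc k₀ ≡ suc k′ →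
         Σ (Code point n k₀) λ c → Isomorphic P (codeGraded c)
  cast c π h refl = c , π , h

-- Enumeration

nils : State → ℕ → ℕ
nils point    zero    = 1
nils point    (suc k) = 0
nils pair     k       = 0
nils oriented k       = 0

-- The summands of `twos` are the edges leaving each state, that is, the rows of the transfer matrix
-- without the steps to a point.
number twos : State → ℕ → ℕ → ℕ
number q zero    k             = nils q k
number q (suc n) zero          = 0
number q (suc n) (suc zero)    = number point n 0
number q (suc n) (suc (suc k)) = number point n (suc k) ℕ.+ twos q n k
twos point    n k = number pair n k
twos pair     n k = number pair n k ℕ.+ (number pair n k ℕ.+ number oriented n k)
twos oriented n k = number pair n k ℕ.+ (number oriented n k ℕ.+ (number oriented n k ℕ.+ number oriented n k))

Twos : State → ℕ → ℕ → Set
Twos q n k = Σ State λ q′ → Edge q q′ × Code q′ n k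

infixr 2 _⊞_
_⊞_ : ∀ {A B : Set} {a b} → A ↔ Fin a → B ↔ Fin b → (A ⊎ B) ↔ Fin (a ℕ.+ b)
f ⊞ g = ↔-sym +↔⊎ ↔-∘ (f ⊎-↔ g)

code-number : ∀ q n k → Code q n k ↔ Fin (number q n k)
twos-number : ∀ q n k → Twos q n k ↔ Fin (twos q n k)

code-number point zero zero = mk↔ₛ′ (λ _ → zero) (λ _ → nil) (λ { zero → refl ; (suc ()) }) (λ { nil → refl })
code-number point    zero    (suc k) = mk↔ₛ′ (λ ()) (λ ()) (λ ()) (λ ())
code-number pair     zero    k       = mk↔ₛ′ (λ ()) (λ ()) (λ ()) (λ ())
code-number oriented zero    k       = mk↔ₛ′ (λ ()) (λ ()) (λ ()) (λ ())
code-number q (suc n) zero = mk↔ₛ′ (λ ()) (λ ()) (λ ()) (λ ())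
code-number q (suc n) (suc zero) = code-number point n 0 ↔-∘
  mk↔ₛ′ (λ { (one c) → c }) one (λ _ → refl) (λ { (one c) → refl })
code-number q (suc n) (suc (suc k)) = (code-number point n (suc k) ⊞ twos-number q n k) ↔-∘ mk↔ₛ′
  (λ { (one c) → inj₁ c ; (two e c) → inj₂ (_ , e , c) })
  (λ { (inj₁ c) → one c ; (inj₂ (_ , e , c)) → two e c })
  (λ { (inj₁ c) → refl ; (inj₂ (_ , e , c)) → refl })
  (λ { (one c) → refl ; (two e c) → refl })

twos-number point n k = code-number pair n k ↔-∘ mk↔ₛ′
  (λ { (_ , full , c) → c }) (λ c → _ , full , c) (λ _ → refl) (λ { (_ , full , c) → refl })
twos-number pair n k = (code-number pair n k ⊞ code-number pair n k ⊞ code-number oriented n k) ↔-∘ mk↔ₛ′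
  (λ { (_ , full , c) → inj₁ c ; (_ , par , c) → inj₂ (inj₁ c) ; (_ , zig , c) → inj₂ (inj₂ c) })
  (λ { (inj₁ c) → _ , full , c ; (inj₂ (inj₁ c)) → _ , par , c ; (inj₂ (inj₂ c)) → _ , zig , c })
  (λ { (inj₁ c) → refl ; (inj₂ (inj₁ c)) → refl ; (inj₂ (inj₂ c)) → refl })
  (λ { (_ , full , c) → refl ; (_ , par , c) → refl ; (_ , zig , c) → refl })
twos-number oriented n k =
  (code-number pair n k ⊞ code-number oriented n k ⊞ code-number oriented n k ⊞ code-number oriented n k) ↔-∘ mk↔ₛ′
  (λ { (_ , full , c) → inj₁ c ; (_ , parᵒ , c) → inj₂ (inj₁ c)
     ; (_ , zigˡ , c) → inj₂ (inj₂ (inj₁ c)) ; (_ , zigʳ , c) → inj₂ (inj₂ (inj₂ c)) })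
  (λ { (inj₁ c) → _ , full , c ; (inj₂ (inj₁ c)) → _ , parᵒ , c
     ; (inj₂ (inj₂ (inj₁ c))) → _ , zigˡ , c ; (inj₂ (inj₂ (inj₂ c))) → _ , zigʳ , c })
  (λ { (inj₁ c) → refl ; (inj₂ (inj₁ c)) → refl ; (inj₂ (inj₂ (inj₁ c))) → refl ; (inj₂ (inj₂ (inj₂ c))) → refl })
  (λ { (_ , full , c) → refl ; (_ , parᵒ , c) → refl ; (_ , zigˡ , c) → refl ; (_ , zigʳ , c) → refl })

-- The bottom is not part of the code, hence the shift by one element.
classes : ℕ → ℕ → ℕ
classes n zero    = 0
classes n (suc k) = number point n k

classes-count : ∀ n k → IsoClassCount n k (classes n k)
classes-count n zero    = (λ ()) , (λ ()) , (λ ()) , λ P _ → ⊥-elim (¬Fin0 (GradedPoset.bot P))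
classes-count n (suc k) =
    (λ i → codeGraded (from i))
  , (λ i → code-multiplicityFree (from i))
  , (λ i j iso → trans (sym (strictlyInverseˡ i)) (trans (cong to (code-unique _ _ iso)) (strictlyInverseˡ j)))
  , λ P mf → let c , iso = code-exists P mf
             in to c , subst (λ d → Isomorphic P (codeGraded d)) (sym (strictlyInverseʳ c)) iso
  where open Inverse (code-number point n k)

-- Power series and the recurrence

sumUpTo-cong : ∀ n {f g : ℕ → ℤ} → (∀ i → f i ≡ g i) → sumUpTo n f ≡ sumUpTo n g
sumUpTo-cong zero    h = h 0
sumUpTo-cong (suc n) h = cong₂ ℤ._+_ (sumUpTo-cong n h) (h (suc n))

sumUpTo-+ : ∀ n (f g : ℕ → ℤ) → sumUpTo n (λ i → f i ℤ.+ g i) ≡ sumUpTo n f ℤ.+ sumUpTo n g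
sumUpTo-+ zero    f g = refl
sumUpTo-+ (suc n) f g = trans (cong (ℤ._+ (f (suc n) ℤ.+ g (suc n))) (sumUpTo-+ n f g))
  (solve 4 (λ a b c d → (a :+ b) :+ (c :+ d) := (a :+ c) :+ (b :+ d)) refl (sumUpTo n f) (sumUpTo n g) _ _)
  where open +-*-Solver

sumUpTo-0 : ∀ n → sumUpTo n (λ _ → + 0) ≡ + 0
sumUpTo-0 zero    = refl
sumUpTo-0 (suc n) = cong (ℤ._+ (+ 0)) (sumUpTo-0 n)

sumUpTo-suc : ∀ n (f : ℕ → ℤ) → sumUpTo (suc n) f ≡ f 0 ℤ.+ sumUpTo n (f ∘ suc)
sumUpTo-suc zero    f = refl
sumUpTo-suc (suc n) f = trans (cong (ℤ._+ f (suc (suc n))) (sumUpTo-suc n f)) (ℤ.+-assoc (f 0) _ _)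

-- Multiplication of a one-variable series by the `a`-th power of its variable.
shift : ℕ → (ℕ → ℤ) → ℕ → ℤ
shift zero    f n       = f n
shift (suc a) f zero    = + 0
shift (suc a) f (suc n) = shift a f n

shift-cong : ∀ a {f g : ℕ → ℤ} → (∀ n → f n ≡ g n) → ∀ n → shift a f n ≡ shift a g n
shift-cong zero    h n       = h n
shift-cong (suc a) h zero    = refl
shift-cong (suc a) h (suc n) = shift-cong a h n

shift-+ : ∀ a (f g : ℕ → ℤ) n → shift a (λ m → f m ℤ.+ g m) n ≡ shift a f n ℤ.+ shift a g n
shift-+ zero    f g n       = refl
shift-+ (suc a) f g zero    = refl
shift-+ (suc a) f g (suc n) = shift-+ a f g n

shift-* : ∀ a c (f : ℕ → ℤ) n → shift a (λ m → c ℤ.* f m) n ≡ c ℤ.* shift a f n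
shift-* zero    c f n       = refl
shift-* (suc a) c f zero    = sym (ℤ.*-zeroʳ c)
shift-* (suc a) c f (suc n) = shift-* a c f n

shift-shift : ∀ a b (f : ℕ → ℤ) n → shift a (shift b f) n ≡ shift (a ℕ.+ b) f n
shift-shift zero    b f n       = refl
shift-shift (suc a) b f zero    = refl
shift-shift (suc a) b f (suc n) = shift-shift a b f n

sumUpTo-pick : ∀ a (f : ℕ → ℤ) n → sumUpTo n (λ i → if a ≡ᵇ i then f (n ∸ i) else + 0) ≡ shift a f n
sumUpTo-pick zero    f zero    = refl
sumUpTo-pick (suc a) f zero    = refl
sumUpTo-pick zero    f (suc n) = trans (sumUpTo-suc n _)
  (trans (cong (λ w → f (suc n) ℤ.+ w) (sumUpTo-0 n)) (ℤ.+-identityʳ _))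
sumUpTo-pick (suc a) f (suc n) = trans (sumUpTo-suc n _) (trans (ℤ.+-identityˡ _) (sumUpTo-pick a f n))

terms : List (ℕ × ℕ × ℤ) → Series → Series
terms []                 f n k = + 0
terms ((a , b , c) ∷ ts) f n k = c ℤ.* shift a (λ m → shift b (f m) k) n ℤ.+ terms ts f n k

poly-⋆ : ∀ ts f n k → (poly ts ⋆ f) n k ≡ terms ts f n k
poly-⋆ [] f n k = trans (sumUpTo-cong n λ i → trans (sumUpTo-cong k λ j → ℤ.*-zeroˡ (f (n ∸ i) (k ∸ j))) (sumUpTo-0 k)) (sumUpTo-0 n)
poly-⋆ ((a , b , c) ∷ ts) f n k = begin
  sumUpTo n (λ i → sumUpTo k (λ j → (mono i j ℤ.+ poly ts i j) ℤ.* f (n ∸ i) (k ∸ j)))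
    ≡⟨ sumUpTo-cong n (λ i → trans (sumUpTo-cong k (λ j → ℤ.*-distribʳ-+ (f (n ∸ i) (k ∸ j)) (mono i j) (poly ts i j)))
         (sumUpTo-+ k _ _)) ⟩
  sumUpTo n (λ i → sumUpTo k (λ j → mono i j ℤ.* f (n ∸ i) (k ∸ j))
                   ℤ.+ sumUpTo k (λ j → poly ts i j ℤ.* f (n ∸ i) (k ∸ j)))
    ≡⟨ sumUpTo-+ n _ _ ⟩
  sumUpTo n (λ i → sumUpTo k (λ j → mono i j ℤ.* f (n ∸ i) (k ∸ j))) ℤ.+ (poly ts ⋆ f) n k
    ≡⟨ cong₂ ℤ._+_ (sumUpTo-cong n row) (poly-⋆ ts f n k) ⟩
  sumUpTo n (λ i → if a ≡ᵇ i then c ℤ.* shift b (f (n ∸ i)) k else + 0) ℤ.+ terms ts f n k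
    ≡⟨ cong (ℤ._+ terms ts f n k) (trans (sumUpTo-pick a (λ m → c ℤ.* shift b (f m) k) n) (shift-* a c _ n)) ⟩
  terms ((a , b , c) ∷ ts) f n k ∎
  where
  open ≡-Reasoning
  mono : ℕ → ℕ → ℤ
  mono i j = if (a ≡ᵇ i) ∧ (b ≡ᵇ j) then c else + 0
  if-* : ∀ p (x : ℤ) → (if p then c else + 0) ℤ.* x ≡ (if p then c ℤ.* x else + 0)
  if-* true  x = refl
  if-* false x = ℤ.*-zeroˡ x
  row : ∀ i → sumUpTo k (λ j → mono i j ℤ.* f (n ∸ i) (k ∸ j)) ≡ (if a ≡ᵇ i then c ℤ.* shift b (f (n ∸ i)) k else + 0)
  row i with a ≡ᵇ i
  ... | true  = trans (sumUpTo-cong k λ j → if-* (b ≡ᵇ j) (f (n ∸ i) (k ∸ j)))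
                  (trans (sumUpTo-pick b (λ m → c ℤ.* f (n ∸ i) m) k) (shift-* b c _ k))
  ... | false = trans (sumUpTo-cong k λ j → ℤ.*-zeroˡ (f (n ∸ i) (k ∸ j))) (sumUpTo-0 k)

numberℤ twosℤ : State → ℕ → ℕ → ℤ
numberℤ q n k = + number q n k
twosℤ q n k = + twos q n k

-- One step of the automaton as an identity of series in y. The extra factor `j` turns it into a
-- rewrite rule for every power of y that occurs in `recurrence`.
numberℤ-suc : ∀ q n j k → shift j (numberℤ q (suc n)) k ≡ shift (suc j) (numberℤ point n) k ℤ.+ shift (suc (suc j)) (twosℤ q n) k
numberℤ-suc q n zero    zero          = refl
numberℤ-suc q n zero    (suc zero)    = sym (ℤ.+-identityʳ _)
numberℤ-suc q n zero    (suc (suc k)) = refl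
numberℤ-suc q n (suc j) zero          = refl
numberℤ-suc q n (suc j) (suc k)       = numberℤ-suc q n j k

twosℤ-pair : ∀ n j k → shift j (twosℤ pair n) k ≡
         shift j (numberℤ pair n) k ℤ.+ (shift j (numberℤ pair n) k ℤ.+ shift j (numberℤ oriented n) k)
twosℤ-pair n j k = trans (shift-+ j (numberℤ pair n) _ k) (cong (λ w → shift j (numberℤ pair n) k ℤ.+ w) (shift-+ j (numberℤ pair n) _ k))

twosℤ-oriented : ∀ n j k → shift j (twosℤ oriented n) k ≡ shift j (numberℤ pair n) k ℤ.+
             (shift j (numberℤ oriented n) k ℤ.+ (shift j (numberℤ oriented n) k ℤ.+ shift j (numberℤ oriented n) k))
twosℤ-oriented n j k = trans (shift-+ j (numberℤ pair n) _ k) (cong (λ w → shift j (numberℤ pair n) k ℤ.+ w)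
  (trans (shift-+ j (numberℤ oriented n) _ k) (cong (λ w → shift j (numberℤ oriented n) k ℤ.+ w) (shift-+ j (numberℤ oriented n) _ k))))

-- The Cayley–Hamilton identity of the transfer matrix of the three states.
recurrence : ∀ n k →
  + 1 ℤ.* shift 1 (numberℤ point (3 ℕ.+ n)) k ℤ.+
  (- + 1 ℤ.* shift 2 (numberℤ point (2 ℕ.+ n)) k ℤ.+
  (- + 5 ℤ.* shift 3 (numberℤ point (2 ℕ.+ n)) k ℤ.+
  (+ 4 ℤ.* shift 4 (numberℤ point (1 ℕ.+ n)) k ℤ.+
  (+ 5 ℤ.* shift 5 (numberℤ point (1 ℕ.+ n)) k ℤ.+
  (- + 3 ℤ.* shift 6 (numberℤ point n) k ℤ.+ + 0))))) ≡ + 0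
recurrence n k
  rewrite numberℤ-suc point (2 ℕ.+ n) 1 k
        | numberℤ-suc point (1 ℕ.+ n) 2 k | numberℤ-suc point (1 ℕ.+ n) 3 k | numberℤ-suc pair (1 ℕ.+ n) 3 k | twosℤ-pair (1 ℕ.+ n) 5 k
        | numberℤ-suc point n 3 k | numberℤ-suc point n 4 k | numberℤ-suc point n 5 k | numberℤ-suc pair n 4 k | numberℤ-suc pair n 5 k | numberℤ-suc oriented n 5 k
        | twosℤ-pair n 6 k | twosℤ-pair n 7 k | twosℤ-oriented n 7 k =
  -- `p`, `r`, `o` stand for point, pair and oriented at length `n`, with the shift as index; a
  -- capital with index `1j` is the series at length `n + 1` shifted by `j`.
  solve 8 (λ p₄ p₅ p₆ r₅ r₆ r₇ o₆ o₇ →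
    let P₁₃ = p₄ :+ r₅
        P₁₄ = p₅ :+ r₆
        P₁₅ = p₆ :+ r₇
        R₁₄ = p₅ :+ (r₆ :+ (r₆ :+ o₆))
        R₁₅ = p₆ :+ (r₇ :+ (r₇ :+ o₇))
        O₁₅ = p₆ :+ (r₇ :+ (o₇ :+ (o₇ :+ o₇)))
    in con (+ 1) :* ((P₁₃ :+ R₁₄) :+ (P₁₄ :+ (R₁₅ :+ (R₁₅ :+ O₁₅))))
       :+ (con (- + 1) :* (P₁₃ :+ R₁₄)
       :+ (con (- + 5) :* (P₁₄ :+ R₁₅)
       :+ (con (+ 4) :* P₁₄
       :+ (con (+ 5) :* P₁₅
       :+ (con (- + 3) :* p₆ :+ con (+ 0)))))) := con (+ 0)) refl
    (shift 4 (numberℤ point n) k) (shift 5 (numberℤ point n) k) (shift 6 (numberℤ point n) k)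
    (shift 5 (numberℤ pair n) k) (shift 6 (numberℤ pair n) k) (shift 7 (numberℤ pair n) k)
    (shift 6 (numberℤ oriented n) k) (shift 7 (numberℤ oriented n) k)
  where open +-*-Solver

-- In positive rank `U classes` is y times the series of `number point`, the factor y being the
-- bottom element.
U-suc : ∀ n j k → shift j (U classes (suc n)) k ≡ shift (j ℕ.+ 1) (numberℤ point (suc n)) k
U-suc n j k = trans (shift-cong j
  {g = shift 1 (numberℤ point (suc n))} (λ { zero → refl ; (suc zero) → refl ; (suc (suc k)) → refl }) k)
  (shift-shift j 1 (numberℤ point (suc n)) k)

denominator : List (ℕ × ℕ × ℤ)
denominator = (0 , 0 , + 1) ∷ (1 , 1 , - + 1) ∷ (1 , 2 , - + 5)
            ∷ (2 , 3 , + 4) ∷ (2 , 4 , + 5) ∷ (3 , 5 , - + 3) ∷ []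

classes-series : ∀ n k → terms denominator (U classes) n k ≡ numer n k
classes-series 0 k = refl
classes-series 1 0 = refl
classes-series 1 1 = refl
classes-series 1 2 = refl
classes-series 1 (suc (suc (suc k))) = refl
classes-series 2 0 = refl
classes-series 2 1 = refl
classes-series 2 2 = refl
classes-series 2 3 = refl
classes-series 2 4 = refl
classes-series 2 (suc (suc (suc (suc (suc k))))) = refl
classes-series 3 0 = refl
classes-series 3 1 = refl
classes-series 3 2 = refl
classes-series 3 3 = refl
classes-series 3 4 = refl
classes-series 3 5 = refl
classes-series 3 6 = refl
classes-series 3 (suc (suc (suc (suc (suc (suc (suc k))))))) = refl
-- `U` vanishes in rank 0 while `number point` counts the empty walk there, so the recurrence
-- applies only once rank 0 is out of reach, from rank 4 on. The earlier rows carry the numerator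
-- and are computed.
classes-series (suc (suc (suc (suc n)))) k
  rewrite U-suc (3 ℕ.+ n) 0 k | U-suc (2 ℕ.+ n) 1 k | U-suc (2 ℕ.+ n) 2 k
        | U-suc (1 ℕ.+ n) 3 k | U-suc (1 ℕ.+ n) 4 k | U-suc n 5 k = recurrence (suc n) k

theorem4p2 : Σ (ℕ → ℕ → ℕ) (λ h →
    (∀ n k → IsoClassCount n k (h n k))
    × (∀ n k → (denom ⋆ U h) n k ≡ numer n k))
theorem4p2 = classes , classes-count , λ n k → trans (poly-⋆ denominator (U classes) n k) (classes-series n k)
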